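{- There exists an absolute constant $c > 0$ such that for every finite set $A \subset \mathbb{C}$ with $|A| \geq 2$, $$|A + A \cdot A| \geq c \cdot \frac{|A|^{1.5}}{\sqrt{\log |A|}}.$$
   Context: For $A \subset \mathbb{C}$, $A + A \cdot A = \{a + bc : a, b, c \in A\}$. -}

module Defs where

open import Data.Nat as ℕ using (ℕ; zero; suc; z≤n; s≤s)
import Data.Nat.Properties as ℕ
import Data.Integer as ℤ
import Data.Integer.Properties as ℤ
open import Data.Rational.Base as ℚ using (ℚ; mkℚ; 0ℚ; 1ℚ; ½; ∣_∣; ↥_; 1/_; toℚᵘ)
open import Data.Rational.Properties as ℚ using (module ≤-Reasoning)
open import Data.Rational.Unnormalised as ℚᵘ using (mkℚᵘ)
import Data.Rational.Unnormalised.Properties as ℚᵘ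
open import Data.Rational.Solver using (module +-*-Solver)
open import Algebra.Bundles using (CommutativeMonoid)
open import Algebra.Definitions.RawSemiring ℚ.+-*-rawSemiring using (_^_) renaming (_×_ to _·_)
open import Algebra.Properties.CommutativeSemigroup
  (CommutativeMonoid.commutativeSemigroup ℚ.+-0-commutativeMonoid)
  using () renaming (interchange to +-interchange)
open import Data.Product using (∃-syntax; _×_; _,_; proj₁; proj₂)
open import Data.Sum using (inj₁; inj₂)
open import Data.List using (List; []; _∷_; length)
open import Data.List.Relation.Unary.All.Properties using (All¬⇒¬Any)
open import Data.List.Relation.Unary.Any as Any using (here; there)
open import Data.List.Relation.Unary.AllPairs using ([]; _∷_)
open import Function.Bundles using (_⇔_; mk⇔)
open import Level using (0ℓ)
open import Relation.Binary.Bundles using (Setoid)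
open import Relation.Binary.PropositionalEquality
  using (_≡_; refl; sym; trans; cong; cong₂; subst; subst₂; module ≡-Reasoning)
open import Relation.Nullary using (¬_; yes; no; contradiction)
open import Relation.Unary using (Pred; _⊆_; _≐_)

module _ where
  open import Data.Rational.Base
  open import Data.Rational.Properties
  open +-*-Solver

  recip : ℚ → ℚ
  recip p with p ℚ.≟ 0ℚ
  ... | yes _   = 0ℚ
  ... | no  p≢0 = (1/ p) {{≢-nonZero p≢0}}

  fromℕℚ : ℕ → ℚ
  fromℕℚ n = n · 1ℚ

  δ : ℕ → ℚ
  δ k = recip (fromℕℚ (suc k))

  -- The largest element of {0, h, 2h, …, bh} whose square is at most q
  -- (0 if there is none).
  gridRoot : (q h : ℚ) → ℕ → ℚ
  gridRoot q h zero    = 0ℚ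
  gridRoot q h (suc b) with (fromℕℚ (suc b) * h) * (fromℕℚ (suc b) * h) ≤? q
  ... | yes _ = fromℕℚ (suc b) * h
  ... | no  _ = gridRoot q h b

  -- |numerator of q| bounds q, so this many steps of 1/(n+1) reach past the square
  -- root of q, and gridRoot then falls short of it by less than one step (<root²).
  rootBound : ℚ → ℕ → ℕ
  rootBound q n = suc ℤ.∣ ↥ q ∣ ℕ.* suc n

  -- 1 - 1/(k+1)
  ratio : ℕ → ℚ
  ratio k = fromℕℚ k * δ k

  -- The partial sum Σ_{i=1}^{m} rⁱ / i.
  logSum : ℚ → ℕ → ℚ
  logSum r zero    = 0ℚ
  logSum r (suc m) = logSum r m + r ^ suc m * δ m

  abstract
    ∣p-q∣<ε : ∀ {p q ε} → p < q + ε → q < p + ε → ∣ p - q ∣ < ε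
    ∣p-q∣<ε {p} {q} {ε} a b with ∣p∣≡p∨∣p∣≡-p (p - q)
    ... | inj₁ e = subst₂ _<_ (sym e) (solve 2 (λ q ε → q :+ ε :- q := ε) refl q ε)
                     (+-monoˡ-< (- q) a)
    ... | inj₂ e = subst₂ _<_ (trans (solve 2 (λ p q → q :- p := :- (p :- q)) refl p q) (sym e))
                     (solve 2 (λ q ε → q :+ ε :- q := ε) refl p ε)
                     (+-monoˡ-< (- p) b)

    p≤∣p∣ : ∀ p → p ≤ ∣ p ∣
    p≤∣p∣ p with ≤-total 0ℚ p
    ... | inj₁ 0≤p = ≤-reflexive (sym (0≤p⇒∣p∣≡p 0≤p))
    ... | inj₂ p≤0 = ≤-trans p≤0 (0≤∣p∣ p)

    p<q+ε : ∀ {p q ε} → ∣ p - q ∣ < ε → p < q + ε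
    p<q+ε {p} {q} {ε} l = subst (_< q + ε) (solve 2 (λ p q → q :+ (p :- q) := p) refl p q)
      (+-monoʳ-< q (≤-<-trans (p≤∣p∣ (p - q)) l))

    ∣p∣<∣q∣+ε : ∀ {p q ε} → ∣ p - q ∣ < ε → ∣ p ∣ < ∣ q ∣ + ε
    ∣p∣<∣q∣+ε {p} {q} {ε} l = begin-strict
      ∣ p ∣              ≡⟨ cong ∣_∣ (solve 2 (λ p q → p := q :+ (p :- q)) refl p q) ⟩
      ∣ q + (p - q) ∣    ≤⟨ ∣p+q∣≤∣p∣+∣q∣ q (p - q) ⟩
      ∣ q ∣ + ∣ p - q ∣  <⟨ +-monoʳ-< ∣ q ∣ l ⟩
      ∣ q ∣ + ε          ∎
      where open ≤-Reasoning

    0<* : ∀ {p q} → 0ℚ < p → 0ℚ < q → 0ℚ < p * q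
    0<* {p} {q} a b = positive⁻¹ (p * q) {{pos*pos⇒pos p {{positive a}} q {{positive b}}}}

    0≤* : ∀ {p q} → 0ℚ ≤ p → 0ℚ ≤ q → 0ℚ ≤ p * q
    0≤* {p} {q} a b =
      nonNegative⁻¹ (p * q) {{nonNeg*nonNeg⇒nonNeg p {{nonNegative a}} q {{nonNegative b}}}}

    *-mono-≤ : ∀ {p p′ q q′} → 0ℚ ≤ p → p ≤ p′ → 0ℚ ≤ q → q ≤ q′ → p * q ≤ p′ * q′
    *-mono-≤ {p} {p′} {q} {q′} 0≤p p≤p′ 0≤q q≤q′ = ≤-trans
      (*-monoʳ-≤-nonNeg q {{nonNegative 0≤q}} p≤p′)
      (*-monoˡ-≤-nonNeg p′ {{nonNegative (≤-trans 0≤p p≤p′)}} q≤q′)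

    0<½ : 0ℚ < ½
    0<½ = positive⁻¹ ½

    0<1 : 0ℚ < 1ℚ
    0<1 = positive⁻¹ 1ℚ

    ½+½ : ∀ p → ½ * p + ½ * p ≡ p
    ½+½ = solve 1 (λ p → con ½ :* p :+ con ½ :* p := p) refl

    +-½-mono : ∀ {p q p′ q′ ε} → p < q + ½ * ε → p′ < q′ + ½ * ε → p + p′ < q + q′ + ε
    +-½-mono {p} {q} {p′} {q′} {ε} a b = subst (p + p′ <_)
      (trans (+-interchange q (½ * ε) q′ (½ * ε)) (cong (q + q′ +_) (½+½ ε)))
      (+-mono-< {p} {q + ½ * ε} {p′} {q′ + ½ * ε} a b)

    recip-inverse : ∀ {p} → 0ℚ < p → recip p * p ≡ 1ℚ
    recip-inverse {p} 0<p with p ℚ.≟ 0ℚ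
    ... | yes p≡0 = contradiction (sym p≡0) (<⇒≢ 0<p)
    ... | no  p≢0 = *-inverseˡ p {{≢-nonZero p≢0}}

    0<recip : ∀ {p} → 0ℚ < p → 0ℚ < recip p
    0<recip {p} 0<p = *-cancelʳ-<-nonNeg p {{nonNegative (<⇒≤ 0<p)}}
      (subst₂ _<_ (sym (*-zeroˡ p)) (sym (recip-inverse 0<p)) 0<1)

    shrink : ∀ {K ε} → 0ℚ < K → 0ℚ < ε → ∃[ δ ] (0ℚ < δ × K * δ ≡ ε)
    shrink {K} {ε} 0<K 0<ε = recip K * ε , 0<* (0<recip 0<K) 0<ε ,
      trans (solve 3 (λ K r ε → K :* (r :* ε) := r :* K :* ε) refl K (recip K) ε)
        (trans (cong (_* ε) (recip-inverse 0<K)) (*-identityˡ ε))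

    fromℕℚ-< : ∀ n → fromℕℚ n < fromℕℚ (suc n)
    fromℕℚ-< n = subst (_< fromℕℚ (suc n)) (+-identityˡ (fromℕℚ n)) (+-monoˡ-< (fromℕℚ n) 0<1)

    0≤fromℕℚ : ∀ n → 0ℚ ≤ fromℕℚ n
    0≤fromℕℚ zero    = ≤-refl
    0≤fromℕℚ (suc n) = ≤-trans (0≤fromℕℚ n) (<⇒≤ (fromℕℚ-< n))

    0<fromℕℚ : ∀ n → 0ℚ < fromℕℚ (suc n)
    0<fromℕℚ n = ≤-<-trans (0≤fromℕℚ n) (fromℕℚ-< n)

    fromℕℚ-mono : ∀ {m n} → m ℕ.≤ n → fromℕℚ m ≤ fromℕℚ n
    fromℕℚ-mono {n = n} z≤n     = 0≤fromℕℚ n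
    fromℕℚ-mono         (s≤s l) = +-monoʳ-≤ 1ℚ (fromℕℚ-mono l)

    fromℕℚ-+ : ∀ m n → fromℕℚ (m ℕ.+ n) ≡ fromℕℚ m + fromℕℚ n
    fromℕℚ-+ zero    n = sym (+-identityˡ (fromℕℚ n))
    fromℕℚ-+ (suc m) n = trans (cong (1ℚ +_) (fromℕℚ-+ m n))
                               (sym (+-assoc 1ℚ (fromℕℚ m) (fromℕℚ n)))

    fromℕℚ-* : ∀ m n → fromℕℚ (m ℕ.* n) ≡ fromℕℚ m * fromℕℚ n
    fromℕℚ-* zero    n = sym (*-zeroˡ (fromℕℚ n))
    fromℕℚ-* (suc m) n = trans (fromℕℚ-+ n (m ℕ.* n)) (trans (cong (fromℕℚ n +_) (fromℕℚ-* m n))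
      (solve 2 (λ m n → n :+ m :* n := (con 1ℚ :+ m) :* n) refl (fromℕℚ m) (fromℕℚ n)))

    toℚᵘ-fromℕℚ : ∀ n → toℚᵘ (fromℕℚ n) ℚᵘ.≃ mkℚᵘ (ℤ.+ n) 0
    toℚᵘ-fromℕℚ zero    = ℚᵘ.≃-refl
    toℚᵘ-fromℕℚ (suc n) = ℚᵘ.≃-trans (toℚᵘ-homo-+ 1ℚ (fromℕℚ n))
      (ℚᵘ.≃-trans (ℚᵘ.+-congʳ (toℚᵘ 1ℚ) (toℚᵘ-fromℕℚ n))
        (ℚᵘ.*≡* (cong (ℤ._* ℤ.+ 1) (cong (ℤ._+_ (ℤ.+ 1)) (ℤ.*-identityʳ (ℤ.+ n))))))

    p≤∣↥p∣ : ∀ p → p ≤ fromℕℚ ℤ.∣ ↥ p ∣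
    p≤∣↥p∣ p@(mkℚ i d _) = toℚᵘ-cancel-≤
      (ℚᵘ.≤-respʳ-≃ (ℚᵘ.≃-sym (toℚᵘ-fromℕℚ ℤ.∣ i ∣)) (ℚᵘ.*≤* (bound i)))
      where
      bound : ∀ i → i ℤ.* ℤ.+ 1 ℤ.≤ ℤ.+ ℤ.∣ i ∣ ℤ.* ℤ.+ suc d
      bound (ℤ.+ n)      = ℤ.*-monoˡ-≤-nonNeg (ℤ.+ n) (ℤ.+≤+ (s≤s z≤n))
      bound ℤ.-[1+ n ]   = ℤ.-≤+

    0<δ : ∀ k → 0ℚ < δ k
    0<δ k = 0<recip (0<fromℕℚ k)

    δ-inverse : ∀ k → δ k * fromℕℚ (suc k) ≡ 1ℚ
    δ-inverse k = recip-inverse (0<fromℕℚ k)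

    δ-antimono : ∀ {m n} → m ℕ.≤ n → δ n ≤ δ m
    δ-antimono {m} {n} m≤n = begin
      δ n                          ≡⟨ *-identityˡ (δ n) ⟨
      1ℚ * δ n                     ≡⟨ cong (_* δ n) (δ-inverse m) ⟨
      δ m * fromℕℚ (suc m) * δ n   ≡⟨ solve 3 (λ a b c → a :* b :* c := a :* c :* b) refl (δ m) _ (δ n) ⟩
      δ m * δ n * fromℕℚ (suc m)   ≤⟨ *-monoˡ-≤-nonNeg (δ m * δ n)
                                        {{nonNegative (<⇒≤ (0<* (0<δ m) (0<δ n)))}} (fromℕℚ-mono (s≤s m≤n)) ⟩
      δ m * δ n * fromℕℚ (suc n)   ≡⟨ *-assoc (δ m) (δ n) _ ⟩
      δ m * (δ n * fromℕℚ (suc n)) ≡⟨ cong (δ m *_) (δ-inverse n) ⟩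
      δ m * 1ℚ                     ≡⟨ *-identityʳ (δ m) ⟩
      δ m                          ∎
      where open ≤-Reasoning

    δ-< : ∀ {ε} N → 0ℚ < ε → recip ε < fromℕℚ (suc N) → δ N < ε
    δ-< {ε} N 0<ε l = begin-strict
      δ N                          ≡⟨ *-identityʳ (δ N) ⟨
      δ N * 1ℚ                     ≡⟨ cong (δ N *_) (recip-inverse 0<ε) ⟨
      δ N * (recip ε * ε)          ≡⟨ *-assoc (δ N) (recip ε) ε ⟨
      δ N * recip ε * ε            <⟨ *-monoˡ-<-pos ε {{positive 0<ε}}
                                        (*-monoʳ-<-pos (δ N) {{positive (0<δ N)}} l) ⟩
      δ N * fromℕℚ (suc N) * ε     ≡⟨ cong (_* ε) (δ-inverse N) ⟩
      1ℚ * ε                       ≡⟨ *-identityˡ ε ⟩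
      ε                            ∎
      where open ≤-Reasoning

    archimedean : ∀ {ε} → 0ℚ < ε → ∃[ N ] (∀ n → N ℕ.≤ n → δ n < ε)
    archimedean {ε} 0<ε = ℤ.∣ ↥ recip ε ∣ , λ n N≤n → ≤-<-trans (δ-antimono N≤n)
      (δ-< ℤ.∣ ↥ recip ε ∣ 0<ε (≤-<-trans (p≤∣↥p∣ (recip ε)) (fromℕℚ-< ℤ.∣ ↥ recip ε ∣)))

    square-<⇒< : ∀ {p q} → 0ℚ ≤ q → p * p < q * q → p < q
    square-<⇒< {p} {q} 0≤q l with q ≤? p
    ... | yes q≤p = contradiction (*-mono-≤ 0≤q q≤p 0≤q q≤p) (λ l′ → <-irrefl refl (<-≤-trans l l′))
    ... | no  q≰p = ≰⇒> q≰p

    *-close : ∀ {B C η} x₁ y₁ x₂ y₂ → 0ℚ < η → ∣ x₁ ∣ < B → ∣ y₂ ∣ < C →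
              ∣ x₁ - x₂ ∣ < η → ∣ y₁ - y₂ ∣ < η → ∣ x₁ * y₁ - x₂ * y₂ ∣ < (B + C) * η
    *-close {B} {C} {η} x₁ y₁ x₂ y₂ 0<η bx by dx dy = begin-strict
      ∣ x₁ * y₁ - x₂ * y₂ ∣
        ≡⟨ cong ∣_∣ (solve 4 (λ a b c d → a :* b :- c :* d := a :* (b :- d) :+ (a :- c) :* d)
                       refl x₁ y₁ x₂ y₂) ⟩
      ∣ x₁ * (y₁ - y₂) + (x₁ - x₂) * y₂ ∣
        ≤⟨ ∣p+q∣≤∣p∣+∣q∣ (x₁ * (y₁ - y₂)) ((x₁ - x₂) * y₂) ⟩
      ∣ x₁ * (y₁ - y₂) ∣ + ∣ (x₁ - x₂) * y₂ ∣
        ≡⟨ cong₂ _+_ (∣p*q∣≡∣p∣*∣q∣ x₁ (y₁ - y₂)) (∣p*q∣≡∣p∣*∣q∣ (x₁ - x₂) y₂) ⟩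
      ∣ x₁ ∣ * ∣ y₁ - y₂ ∣ + ∣ x₁ - x₂ ∣ * ∣ y₂ ∣
        ≤⟨ +-mono-≤
             (*-mono-≤ (0≤∣p∣ x₁) (<⇒≤ bx) (0≤∣p∣ (y₁ - y₂)) (<⇒≤ dy))
             (*-mono-≤ (0≤∣p∣ (x₁ - x₂)) (<⇒≤ dx) (0≤∣p∣ y₂) ≤-refl) ⟩
      B * η + η * ∣ y₂ ∣
        <⟨ +-monoʳ-< (B * η) (*-monoʳ-<-pos η {{positive 0<η}} by) ⟩
      B * η + η * C
        ≡⟨ solve 3 (λ B C η → B :* η :+ η :* C := (B :+ C) :* η) refl B C η ⟩
      (B + C) * η ∎
      where open ≤-Reasoning

    0<∣p∣+1 : ∀ p → 0ℚ < ∣ p ∣ + 1ℚ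
    0<∣p∣+1 p = +-mono-≤-< {0ℚ} {∣ p ∣} {0ℚ} {1ℚ} (0≤∣p∣ p) 0<1

    0<+ : ∀ {p q} → 0ℚ < p → 0ℚ < q → 0ℚ < p + q
    0<+ {p} {q} a b = +-mono-< {0ℚ} {p} {0ℚ} {q} a b

    ∣-∣-neg : ∀ p q → ∣ q - p ∣ ≡ ∣ - p - - q ∣
    ∣-∣-neg p q = cong ∣_∣ (solve 2 (λ p q → q :- p := :- p :- :- q) refl p q)

    inverse-close : ∀ {a b e η u v} → u * a ≡ 1ℚ → v * b ≡ 1ℚ → 0ℚ < u → 0ℚ < v → 0ℚ < e →
                    e < a → e < b → 0ℚ < η → b < a + e * e * η → u < v + η
    inverse-close {a} {b} {e} {η} {u} {v} ua vb 0<u 0<v 0<e e<a e<b 0<η l = begin-strict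
      u                                  ≡⟨ *-identityʳ u ⟨
      u * 1ℚ                             ≡⟨ cong (u *_) vb ⟨
      u * (v * b)                        ≡⟨ *-assoc u v b ⟨
      u * v * b                          <⟨ *-monoʳ-<-pos (u * v) {{positive (0<* 0<u 0<v)}} l ⟩
      u * v * (a + e * e * η)            ≡⟨ solve 5 (λ u v a e η → u :* v :* (a :+ e :* e :* η) :=
                                               v :* (u :* a) :+ (u :* e) :* (v :* e) :* η) refl u v a e η ⟩
      v * (u * a) + u * e * (v * e) * η  ≤⟨ +-monoʳ-≤ (v * (u * a)) (*-monoʳ-≤-nonNeg η {{nonNegative (<⇒≤ 0<η)}}
                                              (*-mono-≤ (0≤* (<⇒≤ 0<u) (<⇒≤ 0<e)) ue≤1
                                                        (0≤* (<⇒≤ 0<v) (<⇒≤ 0<e)) ve≤1)) ⟩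
      v * (u * a) + 1ℚ * 1ℚ * η          ≡⟨ cong₂ _+_ (trans (cong (v *_) ua) (*-identityʳ v)) (*-identityˡ η) ⟩
      v + η                              ∎
      where
      open ≤-Reasoning
      ue≤1 : u * e ≤ 1ℚ
      ue≤1 = subst (u * e ≤_) ua (*-monoˡ-≤-nonNeg u {{nonNegative (<⇒≤ 0<u)}} (<⇒≤ e<a))
      ve≤1 : v * e ≤ 1ℚ
      ve≤1 = subst (v * e ≤_) vb (*-monoˡ-≤-nonNeg v {{nonNegative (<⇒≤ 0<v)}} (<⇒≤ e<b))

    recip-close : ∀ {e η} a b → 0ℚ < e → e < a → e < b → 0ℚ < η →
                  b < a + e * e * η → recip a < recip b + η
    recip-close {e} {η} a b 0<e e<a e<b 0<η l = inverse-close {a} {b} {e} {η} {recip a} {recip b}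
      (recip-inverse (<-trans 0<e e<a)) (recip-inverse (<-trans 0<e e<b))
      (0<recip (<-trans 0<e e<a)) (0<recip (<-trans 0<e e<b)) 0<e e<a e<b 0<η l

    0≤gridRoot : ∀ q {h} → 0ℚ < h → ∀ b → 0ℚ ≤ gridRoot q h b
    0≤gridRoot q     0<h zero    = ≤-refl
    0≤gridRoot q {h} 0<h (suc b) with (fromℕℚ (suc b) * h) * (fromℕℚ (suc b) * h) ≤? q
    ... | yes _ = 0≤* (0≤fromℕℚ (suc b)) (<⇒≤ 0<h)
    ... | no  _ = 0≤gridRoot q 0<h b

    gridRoot²≤ : ∀ q h b {Q} → 0ℚ ≤ Q → q ≤ Q → gridRoot q h b * gridRoot q h b ≤ Q
    gridRoot²≤ q h zero    0≤Q q≤Q = 0≤Q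
    gridRoot²≤ q h (suc b) 0≤Q q≤Q with (fromℕℚ (suc b) * h) * (fromℕℚ (suc b) * h) ≤? q
    ... | yes l = ≤-trans l q≤Q
    ... | no  _ = gridRoot²≤ q h b 0≤Q q≤Q

    <gridRoot² : ∀ q h b → q < (fromℕℚ b * h + h) * (fromℕℚ b * h + h) →
                 q < (gridRoot q h b + h) * (gridRoot q h b + h)
    <gridRoot² q h zero    l = subst (λ z → q < (z + h) * (z + h)) (*-zeroˡ h) l
    <gridRoot² q h (suc b) l with (fromℕℚ (suc b) * h) * (fromℕℚ (suc b) * h) ≤? q
    ... | yes _ = l
    ... | no ¬p = <gridRoot² q h b (subst (λ z → q < z * z) (next (fromℕℚ b) h) (≰⇒> ¬p))
      where
      next : ∀ x h → (1ℚ + x) * h ≡ x * h + h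
      next = solve 2 (λ x h → (con 1ℚ :+ x) :* h := x :* h :+ h) refl

    p<[M+h]² : ∀ {p M h} → p < M → 1ℚ ≤ M → 0ℚ < h → p < (M + h) * (M + h)
    p<[M+h]² {p} {M} {h} p<M 1≤M 0<h = begin-strict
      p                  <⟨ p<M ⟩
      M                  ≡⟨ *-identityʳ M ⟨
      M * 1ℚ             ≤⟨ *-mono-≤ (≤-trans (<⇒≤ 0<1) 1≤M) M≤M+h (<⇒≤ 0<1) (≤-trans 1≤M M≤M+h) ⟩
      (M + h) * (M + h)  ∎
      where
      open ≤-Reasoning
      M≤M+h : M ≤ M + h
      M≤M+h = subst (_≤ M + h) (+-identityʳ M) (+-monoʳ-≤ M (<⇒≤ 0<h))

    rootBound-δ : ∀ q n → fromℕℚ (rootBound q n) * δ n ≡ fromℕℚ (suc ℤ.∣ ↥ q ∣)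
    rootBound-δ q n = trans (cong (_* δ n) (fromℕℚ-* (suc ℤ.∣ ↥ q ∣) (suc n)))
      (trans (*-assoc (fromℕℚ (suc ℤ.∣ ↥ q ∣)) (fromℕℚ (suc n)) (δ n))
        (trans (cong (fromℕℚ (suc ℤ.∣ ↥ q ∣) *_) (trans (*-comm (fromℕℚ (suc n)) (δ n)) (δ-inverse n)))
          (*-identityʳ (fromℕℚ (suc ℤ.∣ ↥ q ∣)))))

    1≤fromℕℚ : ∀ n → 1ℚ ≤ fromℕℚ (suc n)
    1≤fromℕℚ n = subst (_≤ fromℕℚ (suc n)) (+-identityʳ 1ℚ) (+-monoʳ-≤ 1ℚ (0≤fromℕℚ n))

    <root² : ∀ q n → let r = gridRoot q (δ n) (rootBound q n) in q < (r + δ n) * (r + δ n)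
    <root² q n = <gridRoot² q (δ n) (rootBound q n)
      (subst (λ z → q < (z + δ n) * (z + δ n)) (sym (rootBound-δ q n))
        (p<[M+h]² (≤-<-trans (p≤∣↥p∣ q) (fromℕℚ-< ℤ.∣ ↥ q ∣)) (1≤fromℕℚ ℤ.∣ ↥ q ∣) (0<δ n)))

    square-step : ∀ {p q η r s} → 0ℚ < η → 0ℚ < s → (∀ {Q} → 0ℚ ≤ Q → p ≤ Q → r * r ≤ Q) →
                  q < s * s → p < q + η * η → r < s + η
    square-step {p} {q} {η} {r} {s} 0<η 0<s r²≤ q< p< = square-<⇒< {r} {s + η} (<⇒≤ (0<+ 0<s 0<η))
      (begin-strict
        r * r                            ≤⟨ r²≤ (<⇒≤ (0<+ (0<* 0<s 0<s) (0<* 0<η 0<η)))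
                                                (<⇒≤ (<-trans p< (+-monoˡ-< (η * η) q<))) ⟩
        s * s + η * η                    ≡⟨ +-identityʳ (s * s + η * η) ⟨
        s * s + η * η + 0ℚ               <⟨ +-monoʳ-< (s * s + η * η) (0<+ (0<* 0<s 0<η) (0<* 0<s 0<η)) ⟩
        s * s + η * η + (s * η + s * η)  ≡⟨ solve 2 (λ s η → s :* s :+ η :* η :+ (s :* η :+ s :* η)
                                              := (s :+ η) :* (s :+ η)) refl s η ⟩
        (s + η) * (s + η)                ∎)
      where open ≤-Reasoning

    root-close : ∀ {p q η r r′ h} → 0ℚ < η → 0ℚ ≤ r′ → 0ℚ < h → h < η →
                 (∀ {Q} → 0ℚ ≤ Q → p ≤ Q → r * r ≤ Q) → q < (r′ + h) * (r′ + h) →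
                 p < q + η * η → r < r′ + (η + η)
    root-close {p} {q} {η} {r} {r′} {h} 0<η 0≤r′ 0<h h<η r²≤ q< p< = <-trans
      (square-step {p} {q} {η} {r} {r′ + h} 0<η (+-mono-≤-< {0ℚ} {r′} {0ℚ} {h} 0≤r′ 0<h) r²≤ q< p<)
      (subst (_< r′ + (η + η)) (sym (+-assoc r′ h η)) (+-monoʳ-< r′ (+-monoˡ-< η h<η)))

    below-root : ∀ {ε} → 0ℚ < ε → ∃[ η ] (0ℚ < η × η * η ≤ ε)
    below-root {ε} 0<ε with ≤-total ε 1ℚ
    ... | inj₁ ε≤1 = ε , 0<ε , subst (ε * ε ≤_) (*-identityʳ ε)
                                 (*-monoˡ-≤-nonNeg ε {{nonNegative (<⇒≤ 0<ε)}} ε≤1)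
    ... | inj₂ 1≤ε = 1ℚ , 0<1 , 1≤ε

    <root : ∀ {ε η q r h} → 0ℚ ≤ r → 0ℚ < h → η * η ≤ ε → h < ½ * η → 0ℚ + ε < q →
            q < (r + h) * (r + h) → 0ℚ + ½ * η < r
    <root {ε} {η} {q} {r} {h} 0≤r 0<h η²≤ε h< ε<q q< =
      subst₂ _<_ (solve 2 (λ a b → a :+ b :- b := con 0ℚ :+ a) refl (½ * η) (½ * η))
                 (solve 2 (λ a b → a :+ b :- b := a) refl r (½ * η))
        (+-monoˡ-< (- (½ * η)) ½η+½η<r+½η)
      where
      η²<[r+h]² : η * η < (r + h) * (r + h)
      η²<[r+h]² = ≤-<-trans η²≤ε (<-trans (subst (_< q) (+-identityˡ ε) ε<q) q<)
      0≤r+h : 0ℚ ≤ r + h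
      0≤r+h = <⇒≤ (+-mono-≤-< {0ℚ} {r} {0ℚ} {h} 0≤r 0<h)
      ½η+½η<r+½η : ½ * η + ½ * η < r + ½ * η
      ½η+½η<r+½η = subst (_< r + ½ * η) (sym (½+½ η))
        (<-trans (square-<⇒< 0≤r+h η²<[r+h]²) (+-monoʳ-< r h<))

    0≤ratio : ∀ k → 0ℚ ≤ ratio k
    0≤ratio k = 0≤* (0≤fromℕℚ k) (<⇒≤ (0<δ k))

    0<ratio : ∀ k → 0ℚ < ratio (suc k)
    0<ratio k = 0<* (0<fromℕℚ k) (0<δ (suc k))

    ratio+δ : ∀ k → ratio k + δ k ≡ 1ℚ
    ratio+δ k = trans (solve 2 (λ n d → n :* d :+ d := d :* (con 1ℚ :+ n)) refl (fromℕℚ k) (δ k))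
                      (δ-inverse k)

    ratio≤1 : ∀ k → ratio k ≤ 1ℚ
    ratio≤1 k = subst₂ _≤_ (+-identityʳ (ratio k)) (ratio+δ k)
                  (+-monoʳ-≤ (ratio k) (<⇒≤ (0<δ k)))

    1+K*ratio : ∀ k → 1ℚ + fromℕℚ (suc k) * ratio k ≡ fromℕℚ (suc k)
    1+K*ratio k = lemma (fromℕℚ (suc k)) (δ k) (ratio k) (δ-inverse k) (ratio+δ k)
      where
      open ≡-Reasoning
      lemma : ∀ K d r → d * K ≡ 1ℚ → r + d ≡ 1ℚ → 1ℚ + K * r ≡ K
      lemma K d r dK r+d = begin
        1ℚ + K * r      ≡⟨ cong (_+ K * r) dK ⟨
        d * K + K * r   ≡⟨ solve 3 (λ d K r → d :* K :+ K :* r := K :* (r :+ d)) refl d K r ⟩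
        K * (r + d)     ≡⟨ cong (K *_) r+d ⟩
        K * 1ℚ          ≡⟨ *-identityʳ K ⟩
        K               ∎

    0≤^ : ∀ {r} → 0ℚ ≤ r → ∀ m → 0ℚ ≤ r ^ m
    0≤^ 0≤r zero    = <⇒≤ 0<1
    0≤^ 0≤r (suc m) = 0≤* 0≤r (0≤^ 0≤r m)

    ^≤1 : ∀ {r} → 0ℚ ≤ r → r ≤ 1ℚ → ∀ m → r ^ m ≤ 1ℚ
    ^≤1 0≤r r≤1 zero    = ≤-refl
    ^≤1 0≤r r≤1 (suc m) = *-mono-≤ 0≤r r≤1 (0≤^ 0≤r m) (^≤1 0≤r r≤1 m)

    logSum-suc : ∀ {r} → 0ℚ ≤ r → ∀ m → logSum r m ≤ logSum r (suc m)
    logSum-suc {r} 0≤r m = subst (_≤ logSum r (suc m)) (+-identityʳ (logSum r m))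
      (+-monoʳ-≤ (logSum r m) (0≤* (0≤^ 0≤r (suc m)) (<⇒≤ (0<δ m))))

    logSum-mono′ : ∀ {r m n} → 0ℚ ≤ r → m ℕ.≤′ n → logSum r m ≤ logSum r n
    logSum-mono′ 0≤r (ℕ.≤′-reflexive refl) = ≤-refl
    logSum-mono′ {n = suc n} 0≤r (ℕ.≤′-step l) = ≤-trans (logSum-mono′ 0≤r l) (logSum-suc 0≤r n)

    tail-step : ∀ {K D t r p S} → 1ℚ + K * r ≡ K → 0ℚ ≤ p → t ≤ D →
                S + p * t + K * D * (r * p) ≤ S + K * D * p
    tail-step {K} {D} {t} {r} {p} {S} eq 0≤p t≤D = begin
      S + p * t + K * D * (r * p)
        ≤⟨ +-monoˡ-≤ (K * D * (r * p)) (+-monoʳ-≤ S (*-monoˡ-≤-nonNeg p {{nonNegative 0≤p}} t≤D)) ⟩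
      S + p * D + K * D * (r * p)
        ≡⟨ solve 5 (λ K D r p S → S :+ p :* D :+ K :* D :* (r :* p)
                      := S :+ (con 1ℚ :+ K :* r) :* D :* p) refl K D r p S ⟩
      S + (1ℚ + K * r) * D * p
        ≡⟨ cong (λ z → S + z * D * p) eq ⟩
      S + K * D * p ∎
      where open ≤-Reasoning

    logSum-tail : ∀ k {m n} → m ℕ.≤′ n →
      logSum (ratio k) n + fromℕℚ (suc k) * δ m * ratio k ^ suc n ≤
      logSum (ratio k) m + fromℕℚ (suc k) * δ m * ratio k ^ suc m
    logSum-tail k (ℕ.≤′-reflexive refl) = ≤-refl
    logSum-tail k {m} {suc n} (ℕ.≤′-step l) = ≤-trans
      (tail-step {S = logSum (ratio k) n} (1+K*ratio k) (0≤^ (0≤ratio k) (suc n)) (δ-antimono (ℕ.≤′⇒≤ l)))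
      (logSum-tail k l)

    chain : ∀ {a b c D p q ε} → 0ℚ ≤ D → 0ℚ ≤ p → q ≤ 1ℚ → a + D * p ≤ c + D * q →
            c ≤ b → D < ε → a < b + ε
    chain {a} {b} {c} {D} {p} {q} {ε} 0≤D 0≤p q≤1 tail c≤b D<ε = begin-strict
      a           ≡⟨ +-identityʳ a ⟨
      a + 0ℚ      ≤⟨ +-monoʳ-≤ a (0≤* 0≤D 0≤p) ⟩
      a + D * p   ≤⟨ tail ⟩
      c + D * q   ≤⟨ +-mono-≤ c≤b (*-monoˡ-≤-nonNeg D {{nonNegative 0≤D}} q≤1) ⟩
      b + D * 1ℚ  ≡⟨ cong (b +_) (*-identityʳ D) ⟩
      b + D       <⟨ +-monoʳ-< b D<ε ⟩
      b + ε       ∎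
      where open ≤-Reasoning

    logSum-close : ∀ k {N m n ε} → N ℕ.≤ m → N ℕ.≤ n → fromℕℚ (suc k) * δ N < ε →
                   logSum (ratio k) m < logSum (ratio k) n + ε
    logSum-close k {N} {m} {n} {ε} N≤m N≤n l =
      chain {logSum (ratio k) m} {logSum (ratio k) n} {logSum (ratio k) N}
            {fromℕℚ (suc k) * δ N} {ratio k ^ suc m} {ratio k ^ suc N} {ε}
        (0≤* (0≤fromℕℚ (suc k)) (<⇒≤ (0<δ N))) (0≤^ (0≤ratio k) (suc m))
        (^≤1 (0≤ratio k) (ratio≤1 k) (suc N)) (logSum-tail k (ℕ.≤⇒≤′ N≤m))
        (logSum-mono′ (0≤ratio k) (ℕ.≤⇒≤′ N≤n)) l

    0<logSum₁ : ∀ k → 0ℚ < logSum (ratio (suc k)) 1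
    0<logSum₁ k = +-mono-≤-< {0ℚ} {0ℚ} {0ℚ} {ratio (suc k) ^ 1 * δ 0} ≤-refl
      (0<* (0<* (0<ratio k) 0<1) (0<δ 0))

    ½p<p : ∀ {p} → 0ℚ < p → 0ℚ + ½ * p < p
    ½p<p {p} 0<p = subst (0ℚ + ½ * p <_) (½+½ p) (+-monoˡ-< (½ * p) (0<* 0<½ 0<p))

    ∣p-p∣<ε : ∀ p {ε} → 0ℚ < ε → ∣ p - p ∣ < ε
    ∣p-p∣<ε p {ε} 0<ε = subst (_< ε) (sym (cong ∣_∣ (+-inverseʳ p))) 0<ε

    ∣-∣-sym : ∀ p q {ε} → ∣ p - q ∣ < ε → ∣ q - p ∣ < ε
    ∣-∣-sym p q {ε} = subst (_< ε) (trans (sym (∣-p∣≡∣p∣ (p - q)))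
      (cong ∣_∣ (solve 2 (λ p q → :- (p :- q) := q :- p) refl p q)))

    ∣-∣-trans : ∀ p q r {ε} → ∣ p - q ∣ < ½ * ε → ∣ q - r ∣ < ½ * ε → ∣ p - r ∣ < ε
    ∣-∣-trans p q r {ε} a b = begin-strict
      ∣ p - r ∣              ≡⟨ cong ∣_∣ (solve 3 (λ p q r → p :- r := (p :- q) :+ (q :- r)) refl p q r) ⟩
      ∣ (p - q) + (q - r) ∣  ≤⟨ ∣p+q∣≤∣p∣+∣q∣ (p - q) (q - r) ⟩
      ∣ p - q ∣ + ∣ q - r ∣  <⟨ +-mono-< {∣ p - q ∣} {½ * ε} {∣ q - r ∣} {½ * ε} a b ⟩
      ½ * ε + ½ * ε          ≡⟨ ½+½ ε ⟩
      ε                      ∎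
      where open ≤-Reasoning

Cauchy : (ℕ → ℚ) → Set
Cauchy s = ∀ {ε} → 0ℚ ℚ.< ε → ∃[ N ] (∀ m n → N ℕ.≤ m → N ℕ.≤ n → ∣ s m ℚ.- s n ∣ ℚ.< ε)

record ℝ : Set where
  constructor mkℝ
  field
    seq    : ℕ → ℚ
    cauchy : Cauchy seq
open ℝ public

infix 4 _≃_ _<_ _≤_

record _≃_ (x y : ℝ) : Set where
  constructor mk≃
  field
    ≃-close : ∀ {ε} → 0ℚ ℚ.< ε → ∃[ N ] (∀ n → N ℕ.≤ n → ∣ seq x n ℚ.- seq y n ∣ ℚ.< ε)
open _≃_ public

record _<_ (x y : ℝ) : Set where
  constructor mk<
  field
    gap       : ℚ
    0<gap     : 0ℚ ℚ.< gap
    separated : ∃[ N ] (∀ n → N ℕ.≤ n → seq x n ℚ.+ gap ℚ.< seq y n)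
open _<_ public

record _≤_ (x y : ℝ) : Set where
  constructor mk≤
  field
    ≤-close : ∀ {ε} → 0ℚ ℚ.< ε → ∃[ N ] (∀ n → N ℕ.≤ n → seq x n ℚ.< seq y n ℚ.+ ε)
open _≤_ public

OneSided : (ℕ → ℚ) → Set
OneSided s = ∀ {ε} → 0ℚ ℚ.< ε → ∃[ N ] (∀ m n → N ℕ.≤ m → N ℕ.≤ n → s m ℚ.< s n ℚ.+ ε)

fromOneSided : ∀ {s} → OneSided s → Cauchy s
fromOneSided c 0<ε with c 0<ε
... | N , f = N , λ m n a b → ∣p-q∣<ε (f m n a b) (f n m b a)

toOneSided : ∀ {s} → Cauchy s → OneSided s
toOneSided c 0<ε with c 0<ε
... | N , f = N , λ m n a b → p<q+ε (f m n a b)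

ratℝ : ℚ → ℝ
ratℝ q = mkℝ (λ _ → q) λ {ε} 0<ε → 0 , λ _ _ _ _ →
  subst (ℚ._< ε) (sym (cong ∣_∣ (ℚ.+-inverseʳ q))) 0<ε

0ℝ : ℝ
0ℝ = ratℝ 0ℚ

fromℕ : ℕ → ℝ
fromℕ n = ratℝ (fromℕℚ n)

infixl 6 _+_ _-_
infixl 7 _*_
infix  8 -_
infixl 7 _÷_⟨_⟩

_+_ : ℝ → ℝ → ℝ
x + y = mkℝ s (fromOneSided {s} proof)
  where
  s : ℕ → ℚ
  s n = seq x n ℚ.+ seq y n
  proof : OneSided s
  proof {ε} 0<ε = M ℕ.⊔ N , λ m n a b →
    +-½-mono {seq x m} {seq x n} {seq y m} {seq y n} {ε}
      (proj₂ f m n (ℕ.m⊔n≤o⇒m≤o M N a) (ℕ.m⊔n≤o⇒m≤o M N b))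
      (proj₂ g m n (ℕ.m⊔n≤o⇒n≤o M N a) (ℕ.m⊔n≤o⇒n≤o M N b))
    where
    f = toOneSided {seq x} (cauchy x) (0<* {½} {ε} 0<½ 0<ε)
    g = toOneSided {seq y} (cauchy y) (0<* {½} {ε} 0<½ 0<ε)
    M = proj₁ f
    N = proj₁ g

-_ : ℝ → ℝ
- x = mkℝ (λ n → ℚ.- seq x n) proof
  where
  proof : Cauchy (λ n → ℚ.- seq x n)
  proof {ε} 0<ε with cauchy x 0<ε
  ... | N , f = N , λ m n a b → subst (ℚ._< ε) (∣-∣-neg (seq x m) (seq x n)) (f n m b a)

_-_ : ℝ → ℝ → ℝ
x - y = x + (- y)

bounded : ∀ x → ∃[ B ] (0ℚ ℚ.< B × ∃[ N ] (∀ n → N ℕ.≤ n → ∣ seq x n ∣ ℚ.< B))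
bounded x with cauchy x 0<1
... | N , f = ∣ seq x N ∣ ℚ.+ 1ℚ , 0<∣p∣+1 (seq x N) , N , λ n a → ∣p∣<∣q∣+ε (f n N a ℕ.≤-refl)

_*_ : ℝ → ℝ → ℝ
x * y = mkℝ s proof
  where
  s : ℕ → ℚ
  s n = seq x n ℚ.* seq y n
  proof : Cauchy s
  proof {ε} 0<ε =
    let B , 0<B , L , bx = bounded x
        C , 0<C , M , by = bounded y
        η , 0<η , eq     = shrink (0<+ 0<B 0<C) 0<ε
        P , f            = cauchy x 0<η
        Q , g            = cauchy y 0<η
    in (L ℕ.⊔ M) ℕ.⊔ (P ℕ.⊔ Q) , λ m n a b →
       let a₁ = ℕ.m⊔n≤o⇒m≤o (L ℕ.⊔ M) (P ℕ.⊔ Q) a ; a₂ = ℕ.m⊔n≤o⇒n≤o (L ℕ.⊔ M) (P ℕ.⊔ Q) a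
           b₁ = ℕ.m⊔n≤o⇒m≤o (L ℕ.⊔ M) (P ℕ.⊔ Q) b ; b₂ = ℕ.m⊔n≤o⇒n≤o (L ℕ.⊔ M) (P ℕ.⊔ Q) b
       in subst (∣ s m ℚ.- s n ∣ ℚ.<_) eq
            (*-close (seq x m) (seq y m) (seq x n) (seq y n) 0<η
              (bx m (ℕ.m⊔n≤o⇒m≤o L M a₁)) (by n (ℕ.m⊔n≤o⇒n≤o L M b₁))
              (f m n (ℕ.m⊔n≤o⇒m≤o P Q a₂) (ℕ.m⊔n≤o⇒m≤o P Q b₂))
              (g m n (ℕ.m⊔n≤o⇒n≤o P Q a₂) (ℕ.m⊔n≤o⇒n≤o P Q b₂)))

_÷_⟨_⟩ : (x y : ℝ) → 0ℝ < y → ℝ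
x ÷ y ⟨ mk< ε 0<ε (N , ε<y) ⟩ = x * mkℝ s (fromOneSided {s} proof)
  where
  s : ℕ → ℚ
  s n = recip (seq y n)
  above : ∀ {n} → N ℕ.≤ n → ε ℚ.< seq y n
  above {n} a = subst (ℚ._< seq y n) (ℚ.+-identityˡ ε) (ε<y n a)
  proof : OneSided s
  proof {η} 0<η =
    let M , f = toOneSided {seq y} (cauchy y) (0<* (0<* 0<ε 0<ε) 0<η)
    in N ℕ.⊔ M , λ m n a b →
       recip-close (seq y m) (seq y n) 0<ε
         (above (ℕ.m⊔n≤o⇒m≤o N M a)) (above (ℕ.m⊔n≤o⇒m≤o N M b)) 0<η
         (f n m (ℕ.m⊔n≤o⇒n≤o N M b) (ℕ.m⊔n≤o⇒n≤o N M a))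

-- The n-th approximation is the largest multiple of 1/(n+1) whose square is at
-- most the n-th approximation of x, so negative reals are sent to 0.
√ : ℝ → ℝ
√ x = mkℝ s (fromOneSided {s} proof)
  where
  s : ℕ → ℚ
  s n = gridRoot (seq x n) (δ n) (rootBound (seq x n) n)
  proof : OneSided s
  proof {ε} 0<ε =
    let M , f = toOneSided {seq x} (cauchy x) (0<* (0<* 0<½ 0<ε) (0<* 0<½ 0<ε))
        N , g = archimedean (0<* 0<½ 0<ε)
    in M ℕ.⊔ N , λ m n a b →
       subst (λ z → s m ℚ.< s n ℚ.+ z) (½+½ ε)
         (root-close {seq x m} {seq x n} {½ ℚ.* ε} {s m} {s n} {δ n} (0<* 0<½ 0<ε)
           (0≤gridRoot (seq x n) (0<δ n) (rootBound (seq x n) n)) (0<δ n)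
           (g n (ℕ.m⊔n≤o⇒n≤o M N b))
           (gridRoot²≤ (seq x m) (δ m) (rootBound (seq x m) m))
           (<root² (seq x n) n)
           (f m n (ℕ.m⊔n≤o⇒m≤o M N a) (ℕ.m⊔n≤o⇒m≤o M N b)))

√-pos : ∀ {x} → 0ℝ < x → 0ℝ < √ x
√-pos {x} (mk< ε 0<ε (M , ε<x)) =
  let η , 0<η , η²≤ε = below-root 0<ε
      N , g          = archimedean (0<* 0<½ 0<η)
  in mk< (½ ℚ.* η) (0<* 0<½ 0<η) (M ℕ.⊔ N , λ n a →
     <root {ε} {η} {seq x n} {seq (√ x) n} {δ n}
       (0≤gridRoot (seq x n) (0<δ n) (rootBound (seq x n) n)) (0<δ n) η²≤ε
       (g n (ℕ.m⊔n≤o⇒n≤o M N a)) (ε<x n (ℕ.m⊔n≤o⇒m≤o M N a)) (<root² (seq x n) n))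

infix 8 _^1·5
_^1·5 : ℝ → ℝ
x ^1·5 = x * √ x

-- The natural logarithm of n = k + 1, from the Mercator series
-- log n = - log (1 - r) = Σ_{i≥1} rⁱ / i  at  r = 1 - 1/n; log 0 is the junk value 0.
log : ℕ → ℝ
log zero    = 0ℝ
log (suc k) = mkℝ s (fromOneSided {s} proof)
  where
  s : ℕ → ℚ
  s = logSum (ratio k)
  proof : OneSided s
  proof {ε} 0<ε =
    let η , 0<η , eq = shrink (0<fromℕℚ k) 0<ε
        N , g        = archimedean 0<η
    in N , λ m n a b → logSum-close k {N} {m} {n} {ε} a b
         (subst (fromℕℚ (suc k) ℚ.* δ N ℚ.<_) eq
           (ℚ.*-monoʳ-<-pos (fromℕℚ (suc k)) {{ℚ.positive (0<fromℕℚ k)}} (g N ℕ.≤-refl)))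

log-pos : ∀ {n} → 2 ℕ.≤ n → 0ℝ < log n
log-pos {suc (suc k)} (s≤s (s≤s _)) =
  mk< (½ ℚ.* l₁) (0<* 0<½ (0<logSum₁ k)) (1 , λ n 1≤n →
    ℚ.<-≤-trans (½p<p (0<logSum₁ k)) (logSum-mono′ (0≤ratio (suc k)) (ℕ.≤⇒≤′ 1≤n)))
  where l₁ = logSum (ratio (suc k)) 1

≃-refl : ∀ {x} → x ≃ x
≃-refl {x} = mk≃ λ 0<ε → 0 , λ n _ → ∣p-p∣<ε (seq x n) 0<ε

≃-sym : ∀ {x y} → x ≃ y → y ≃ x
≃-sym {x} {y} p = mk≃ λ 0<ε →
  let N , f = ≃-close p 0<ε in N , λ n a → ∣-∣-sym (seq x n) (seq y n) (f n a)

≃-trans : ∀ {x y z} → x ≃ y → y ≃ z → x ≃ z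
≃-trans {x} {y} {z} p q = mk≃ λ 0<ε →
  let M , f = ≃-close p (0<* 0<½ 0<ε)
      N , g = ≃-close q (0<* 0<½ 0<ε)
  in M ℕ.⊔ N , λ n a → ∣-∣-trans (seq x n) (seq y n) (seq z n)
                         (f n (ℕ.m⊔n≤o⇒m≤o M N a)) (g n (ℕ.m⊔n≤o⇒n≤o M N a))

record ℂ : Set where
  constructor _+i_
  field
    re im : ℝ
open ℂ public

infix 4 _≈_
record _≈_ (z w : ℂ) : Set where
  constructor _,_
  field
    re-≃ : re z ≃ re w
    im-≃ : im z ≃ im w
open _≈_ public

≈-refl : ∀ {z} → z ≈ z
≈-refl = ≃-refl , ≃-refl

≈-sym : ∀ {z w} → z ≈ w → w ≈ z
≈-sym (p , q) = ≃-sym p , ≃-sym q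

≈-trans : ∀ {z w v} → z ≈ w → w ≈ v → z ≈ v
≈-trans (p , q) (p′ , q′) = ≃-trans p p′ , ≃-trans q q′

ℂ-setoid : Setoid 0ℓ 0ℓ
ℂ-setoid = record
  { Carrier       = ℂ
  ; _≈_           = _≈_
  ; isEquivalence = record { refl = ≈-refl ; sym = ≈-sym ; trans = ≈-trans }
  }

infixl 6 _+ᶜ_
infixl 7 _*ᶜ_

_+ᶜ_ : ℂ → ℂ → ℂ
(a +i b) +ᶜ (c +i d) = (a + c) +i (b + d)

_*ᶜ_ : ℂ → ℂ → ℂ
(a +i b) *ᶜ (c +i d) = (a * c - b * d) +i (a * d + b * c)

-- A finite set A ⊂ ℂ is a list that is Unique up to _≈_; its length is then |A|.

open import Data.List.Membership.Setoid ℂ-setoid public using (_∈_)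
open import Data.List.Relation.Unary.Unique.Setoid ℂ-setoid public using (Unique)

_+_∙_ : (A B C : List ℂ) → Pred ℂ 0ℓ
(A + B ∙ C) z = ∃[ a ] ∃[ b ] ∃[ c ] (a ∈ A × b ∈ B × c ∈ C × z ≈ a +ᶜ b *ᶜ c)

-- "S has at least r elements".  Since _≈_ is undecidable, S cannot in general be
-- listed without repetition constructively, so the cardinality of S is read as the
-- least length of a list containing S; ∣S∣≥⇔ shows this is the number of elements
-- as soon as S is listed without repetition.
infix 4 ∣_∣≥_
∣_∣≥_ : Pred ℂ 0ℓ → ℝ → Set
∣ S ∣≥ r = ∀ (B : List ℂ) → S ⊆ (_∈ B) → r ≤ fromℕ (length B)

remove : ∀ {x ys} → x ∈ ys →
  ∃[ zs ] (length ys ≡ suc (length zs) × (∀ {y} → y ∈ ys → ¬ y ≈ x → y ∈ zs))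
remove {ys = y ∷ ys} (here x≈y) = ys , refl , λ
  { (here z≈y) z≉x → contradiction (≈-trans z≈y (≈-sym x≈y)) z≉x
  ; (there z∈) z≉x → z∈ }
remove {ys = y ∷ ys} (there x∈) =
  let zs , eq , f = remove x∈
  in y ∷ zs , cong suc eq , λ { (here z≈y) z≉x → here z≈y
                              ; (there z∈) z≉x → there (f z∈ z≉x) }

pigeonhole : ∀ {xs ys} → Unique xs → (_∈ xs) ⊆ (_∈ ys) → length xs ℕ.≤ length ys
pigeonhole []       _   = z≤n
pigeonhole {_ ∷ xs} (x∉ ∷ u) sub =
  let zs , eq , f = remove (sub (here ≈-refl))
  in subst (suc (length xs) ℕ.≤_) (sym eq) (s≤s (pigeonhole u λ z∈ →
       f (sub (there z∈)) λ z≈x →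
         All¬⇒¬Any x∉ (Any.map (λ z≈w → ≈-trans (≈-sym z≈x) z≈w) z∈)))

≤-fromℕ : ∀ {r m n} → m ℕ.≤ n → r ≤ fromℕ m → r ≤ fromℕ n
≤-fromℕ m≤n p = mk≤ λ {ε} 0<ε →
  let N , f = ≤-close p 0<ε
  in N , λ k a → ℚ.<-≤-trans (f k a) (ℚ.+-monoˡ-≤ ε (fromℕℚ-mono m≤n))

∣S∣≥⇔ : ∀ {S r L} → Unique L → S ≐ (_∈ L) → ∣ S ∣≥ r ⇔ r ≤ fromℕ (length L)
∣S∣≥⇔ {L = L} u (S⊆L , L⊆S) = mk⇔
  (λ h → h L S⊆L)
  (λ r≤ B S⊆B → ≤-fromℕ (pigeonhole u (λ z∈L → S⊆B (L⊆S z∈L))) r≤)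

{-# OPTIONS --safe #-}

-- Let B list the elements of A + A·A. For c ∈ A let c′ be a nearest neighbour of c in A. For
-- fixed a and b ≠ 0 the map z ↦ a + bz scales distances, so the closed discs with centre
-- s = a + bc and s′ = a + bc′ on the boundary cover each point at most 16 times: two centres
-- lying in the same octant around a point would be too close to each other. Hence for at least
-- half of the c ∈ A the disc contains at most 32|B|/|A| points of B. The triple (c, s, s′)
-- determines (a, b), and for each s at most 32|B|/|A| points s′ span a disc with so few
-- points. Therefore |A|²(|A| − 1) ≤ 64|B|², and log |A| ≥ 1/2 is all that is needed of the
-- logarithm.
--
-- Equality and order of reals are undecidable, but finitely many instances can be decided
-- under a double negation, and the resulting bound between natural numbers is stable.

module Submission where

open import Data.Nat as ℕ using (ℕ; zero; suc; z≤n; s≤s)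
import Data.Nat.Properties as ℕ
open import Data.Nat.Tactic.RingSolver using (solve-∀)
open import Data.Fin as Fin using (Fin; zero; suc; punchIn; combine)
import Data.Fin.Properties as Fin
open import Data.List using (List; []; _∷_; length; lookup)
import Data.List.Membership.Propositional.Properties as ∈
import Data.List.Membership.Setoid.Properties as ∈ₛ
import Data.List.Relation.Unary.All as All
open import Data.List.Relation.Unary.AllPairs using ([]; _∷_)
import Data.List.Relation.Unary.Any as Any
import Data.List.Relation.Unary.Any.Properties as Any
open import Data.Product using (∃-syntax; _×_; _,_; proj₁; proj₂)
open import Data.Rational.Base as ℚ using (ℚ; 0ℚ; 1ℚ; ½; ∣_∣)
import Data.Rational.Properties as ℚ
open import Data.Rational.Solver using (module +-*-Solver)
open import Data.Sum using (_⊎_; inj₁; inj₂; [_,_]′)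
open import Algebra.Properties.Semiring.Sum ℕ.+-*-semiring
  using (sum; sum-syntax; ∑-comm; ∑-distrib-+; sum-cong-≗; *-distribˡ-sum)
open import Effect.Monad using (RawMonad)
open import Function using (_∘_; case_of_; id)
open import Relation.Binary.PropositionalEquality
  using (_≡_; _≢_; refl; sym; trans; cong; cong₂; subst; subst₂)
open import Relation.Nullary
  using (¬_; Dec; yes; no; contradiction; ¬?; ¬¬-excluded-middle; decidable-stable)
open import Relation.Nullary.Negation using (¬¬-Monad)
open import Relation.Unary using (_⊆_)
open +-*-Solver using (solve; _:+_; _:*_; _:-_; :-_; con; _:=_)

-- Double counting

module _ where
  open import Data.Nat.Base using (_+_; _*_; _≤_; _<_)
  open import Data.Nat.Properties using (module ≤-Reasoning)
  open ≤-Reasoning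

  𝟙 : ∀ {P : Set} → Dec P → ℕ
  𝟙 (yes _) = 1
  𝟙 (no  _) = 0

  𝟙≤1 : ∀ {P} (P? : Dec P) → 𝟙 P? ≤ 1
  𝟙≤1 (yes _) = ℕ.≤-refl
  𝟙≤1 (no  _) = z≤n

  𝟙≡1 : ∀ {P} (P? : Dec P) → P → 𝟙 P? ≡ 1
  𝟙≡1 (yes _)  p = refl
  𝟙≡1 (no  ¬p) p = contradiction p ¬p

  𝟙≢0⇒ : ∀ {P} (P? : Dec P) → 𝟙 P? ≢ 0 → P
  𝟙≢0⇒ (yes p) _ = p
  𝟙≢0⇒ (no  _) h = contradiction refl h

  𝟙-mono : ∀ {P Q} (P? : Dec P) (Q? : Dec Q) → (P → Q) → 𝟙 P? ≤ 𝟙 Q?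
  𝟙-mono (yes p) Q? f = ℕ.≤-reflexive (sym (𝟙≡1 Q? (f p)))
  𝟙-mono (no  _) Q? f = z≤n

  sum-mono : ∀ {n} {f g : Fin n → ℕ} → (∀ i → f i ≤ g i) → sum f ≤ sum g
  sum-mono {zero}  f≤g = z≤n
  sum-mono {suc n} f≤g = ℕ.+-mono-≤ (f≤g zero) (sum-mono (f≤g ∘ suc))

  sum-const : ∀ n c → ∑[ i < n ] c ≡ n * c
  sum-const zero    c = refl
  sum-const (suc n) c = cong (c +_) (sum-const n c)

  sum≤ : ∀ {n c} {f : Fin n → ℕ} → (∀ i → f i ≤ c) → sum f ≤ n * c
  sum≤ {n} {c} {f} f≤c = begin
    sum f         ≤⟨ sum-mono f≤c ⟩
    ∑[ i < n ] c  ≡⟨ sum-const n c ⟩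
    n * c         ∎

  ≤sum : ∀ {n c} {f : Fin n → ℕ} → (∀ i → c ≤ f i) → n * c ≤ sum f
  ≤sum {n} {c} {f} c≤f = begin
    n * c         ≡⟨ sum-const n c ⟨
    ∑[ i < n ] c  ≤⟨ sum-mono c≤f ⟩
    sum f         ∎

  term≤sum : ∀ {n} (f : Fin n → ℕ) i → f i ≤ sum f
  term≤sum f zero    = ℕ.m≤m+n (f zero) _
  term≤sum f (suc i) = ℕ.≤-trans (term≤sum (f ∘ suc) i) (ℕ.m≤n+m _ (f zero))

  sum≢0⇒ : ∀ {n} (f : Fin n → ℕ) → sum f ≢ 0 → ∃[ i ] f i ≢ 0
  sum≢0⇒ {zero}  f h = contradiction refl h
  sum≢0⇒ {suc n} f h with f zero ℕ.≟ 0
  ... | no  f₀≢0 = zero , f₀≢0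
  ... | yes f₀≡0 with sum≢0⇒ (f ∘ suc) (λ e → h (cong₂ _+_ f₀≡0 e))
  ...   | i , fᵢ≢0 = suc i , fᵢ≢0

  -- A non-zero first term forces the remaining sum to vanish. In the counts below the terms are
  -- products with indicators, and injectivity leaves at most one of them non-zero.
  sum≤-unique : ∀ {n c} (f : Fin n → ℕ) → (∀ i → f i ≤ c) →
                (∀ i j → f i ≢ 0 → f j ≢ 0 → i ≡ j) → sum f ≤ c
  sum≤-unique {zero}  f f≤c u = z≤n
  sum≤-unique {suc n} {c} f f≤c u with f zero ℕ.≟ 0
  ... | yes f₀≡0 = begin
    f zero + sum (f ∘ suc)  ≡⟨ cong (_+ sum (f ∘ suc)) f₀≡0 ⟩
    sum (f ∘ suc)           ≤⟨ sum≤-unique (f ∘ suc) (f≤c ∘ suc)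
                                 (λ i j p q → Fin.suc-injective (u (suc i) (suc j) p q)) ⟩
    c                       ∎
  ... | no f₀≢0 with sum (f ∘ suc) ℕ.≟ 0
  ...   | yes e = begin
    f zero + sum (f ∘ suc)  ≡⟨ cong (f zero +_) e ⟩
    f zero + 0              ≡⟨ ℕ.+-identityʳ (f zero) ⟩
    f zero                  ≤⟨ f≤c zero ⟩
    c                       ∎
  ...   | no h with sum≢0⇒ (f ∘ suc) h
  ...     | i , fᵢ≢0 with () ← u zero (suc i) f₀≢0 fᵢ≢0

  count : ∀ {n} {P : Fin n → Set} → (∀ i → Dec (P i)) → ℕ
  count P? = sum (λ i → 𝟙 (P? i))

  -- Each counted index is spread over the indicators of `class i ≡ q`. After exchanging the sums,
  -- every class q contributes at most 1.
  count≤classes : ∀ {n K} {P : Fin n → Set} (P? : ∀ i → Dec (P i)) (class : Fin n → Fin K) →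
                  (∀ i j → P i → P j → class i ≡ class j → i ≡ j) → count P? ≤ K
  count≤classes {n} {K} P? class inj = begin
    ∑[ i < n ] 𝟙 (P? i)                 ≤⟨ sum-mono (λ i → begin
      𝟙 (P? i)                            ≡⟨ ℕ.*-identityʳ _ ⟨
      𝟙 (P? i) * 1                        ≡⟨ cong (𝟙 (P? i) *_) (𝟙≡1 (class i Fin.≟ class i) refl) ⟨
      e i (class i)                       ≤⟨ term≤sum (e i) (class i) ⟩
      ∑[ q < K ] e i q                    ∎) ⟩
    ∑[ i < n ] ∑[ q < K ] e i q         ≡⟨ ∑-comm e ⟩
    ∑[ q < K ] ∑[ i < n ] e i q         ≤⟨ sum≤ (λ q → sum≤-unique (λ i → e i q)
                                             (λ i → ℕ.*-mono-≤ (𝟙≤1 (P? i)) (𝟙≤1 (class i Fin.≟ q)))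
                                             (λ i j p p′ → inj i j (P-of p) (P-of p′)
                                               (trans (class-of p) (sym (class-of p′))))) ⟩
    K * 1                               ≡⟨ ℕ.*-identityʳ K ⟩
    K                                   ∎
    where
    e : Fin n → Fin K → ℕ
    e i q = 𝟙 (P? i) * 𝟙 (class i Fin.≟ q)
    P-of : ∀ {i q} → e i q ≢ 0 → _
    P-of {i} {q} h = 𝟙≢0⇒ (P? i) (λ z → h (cong (_* 𝟙 (class i Fin.≟ q)) z))
    class-of : ∀ {i q} → e i q ≢ 0 → class i ≡ q
    class-of {i} {q} h = 𝟙≢0⇒ (class i Fin.≟ q)
      (λ z → h (trans (cong (𝟙 (P? i) *_) z) (ℕ.*-zeroʳ (𝟙 (P? i)))))

  ∑∑-comm : ∀ {a b m} (f : Fin a → Fin b → Fin m → ℕ) →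
            ∑[ i < a ] ∑[ j < b ] ∑[ s < m ] f i j s ≡ ∑[ s < m ] ∑[ i < a ] ∑[ j < b ] f i j s
  ∑∑-comm {a} {b} f = trans (sum-cong-≗ (λ i → ∑-comm (f i))) (∑-comm (λ i s → ∑[ j < b ] f i j s))

  -- Each term is expanded over the indicator of (`φ i j`, `ψ i j`) = (s, t). Once s and t are
  -- outermost, injectivity leaves at most one pair (i, j) for each (s, t).
  sum-injective-≤ : ∀ {a b m} (φ ψ : Fin a → Fin b → Fin m) →
    (∀ {i j i′ j′} → φ i j ≡ φ i′ j′ → ψ i j ≡ ψ i′ j′ → i ≡ i′ × j ≡ j′) →
    (f : Fin m → Fin m → ℕ) → ∑[ i < a ] ∑[ j < b ] f (φ i j) (ψ i j) ≤ ∑[ s < m ] ∑[ t < m ] f s t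
  sum-injective-≤ {a} {b} {m} φ ψ inj f = begin
    ∑[ i < a ] ∑[ j < b ] f (φ i j) (ψ i j)
      ≤⟨ sum-mono (λ i → sum-mono λ j → begin
           f (φ i j) (ψ i j)                          ≡⟨ ℕ.*-identityʳ _ ⟨
           f (φ i j) (ψ i j) * (1 * 1)                ≡⟨ cong (f (φ i j) (ψ i j) *_) (cong₂ _*_
                                                           (𝟙≡1 (φ i j Fin.≟ φ i j) refl)
                                                           (𝟙≡1 (ψ i j Fin.≟ ψ i j) refl)) ⟨
           g i j (φ i j) (ψ i j)                      ≤⟨ term≤sum (g i j (φ i j)) (ψ i j) ⟩
           ∑[ t < m ] g i j (φ i j) t                 ≤⟨ term≤sum (λ s → ∑[ t < m ] g i j s t) (φ i j) ⟩
           ∑[ s < m ] ∑[ t < m ] g i j s t            ∎) ⟩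
    ∑[ i < a ] ∑[ j < b ] ∑[ s < m ] ∑[ t < m ] g i j s t
      ≡⟨ ∑∑-comm (λ i j s → ∑[ t < m ] g i j s t) ⟩
    ∑[ s < m ] ∑[ i < a ] ∑[ j < b ] ∑[ t < m ] g i j s t
      ≡⟨ sum-cong-≗ (λ s → ∑∑-comm (λ i j t → g i j s t)) ⟩
    ∑[ s < m ] ∑[ t < m ] ∑[ i < a ] ∑[ j < b ] g i j s t
      ≤⟨ sum-mono (λ s → sum-mono λ t → sum≤-unique (λ i → ∑[ j < b ] g i j s t)
           (λ i → sum≤-unique (λ j → g i j s t) (λ j → g≤f i j s t)
             λ j j′ p q → proj₂ (support-unique p q))
           (λ i i′ p q → let j  , p′ = sum≢0⇒ (λ j → g i j s t) p
                             j′ , q′ = sum≢0⇒ (λ j → g i′ j s t) q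
                         in proj₁ (support-unique p′ q′))) ⟩
    ∑[ s < m ] ∑[ t < m ] f s t ∎
    where
    g : Fin a → Fin b → Fin m → Fin m → ℕ
    g i j s t = f s t * (𝟙 (φ i j Fin.≟ s) * 𝟙 (ψ i j Fin.≟ t))
    g≤f : ∀ i j s t → g i j s t ≤ f s t
    g≤f i j s t = begin
      g i j s t    ≤⟨ ℕ.*-monoʳ-≤ (f s t) (ℕ.*-mono-≤ (𝟙≤1 (φ i j Fin.≟ s)) (𝟙≤1 (ψ i j Fin.≟ t))) ⟩
      f s t * 1    ≡⟨ ℕ.*-identityʳ (f s t) ⟩
      f s t        ∎
    φ-of : ∀ {i j s t} → g i j s t ≢ 0 → φ i j ≡ s
    φ-of {i} {j} {s} {t} h = 𝟙≢0⇒ (φ i j Fin.≟ s)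
      (λ z → h (trans (cong (λ x → f s t * (x * 𝟙 (ψ i j Fin.≟ t))) z) (ℕ.*-zeroʳ (f s t))))
    ψ-of : ∀ {i j s t} → g i j s t ≢ 0 → ψ i j ≡ t
    ψ-of {i} {j} {s} {t} h = 𝟙≢0⇒ (ψ i j Fin.≟ t)
      (λ z → h (trans (cong (λ x → f s t * (𝟙 (φ i j Fin.≟ s) * x)) z)
                 (trans (cong (f s t *_) (ℕ.*-zeroʳ (𝟙 (φ i j Fin.≟ s)))) (ℕ.*-zeroʳ (f s t)))))
    support-unique : ∀ {i j i′ j′ s t} → g i j s t ≢ 0 → g i′ j′ s t ≢ 0 → i ≡ i′ × j ≡ j′
    support-unique {i} {j} {i′} {j′} {s} {t} p q = inj
      (trans (φ-of {i} {j} {s} {t} p) (sym (φ-of {i′} {j′} {s} {t} q)))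
      (trans (ψ-of {i} {j} {s} {t} p) (sym (ψ-of {i′} {j′} {s} {t} q)))

  -- Maxima, and the count of discs with few points

  total⇒refl : ∀ {A : Set} {R : A → A → Set} {x} → Dec (R x x) → (∀ {y z} → ¬ R y z → R z y) → R x x
  total⇒refl (yes r) total = r
  total⇒refl (no ¬r) total = total ¬r

  maximum : ∀ {n} {P : Fin n → Set} {R : Fin n → Fin n → Set} →
            (∀ i → Dec (P i)) → (∀ i j → Dec (R i j)) → (∀ {i j} → ¬ R i j → R j i) →
            (∀ {i j k} → R i j → R j k → R i k) →
            (∀ i → ¬ P i) ⊎ (∃[ i ] (P i × ∀ j → P j → R j i))
  maximum {zero}  P? R? total tr = inj₁ λ ()
  maximum {suc n} {P} {R} P? R? total tr
    with P? zero | maximum {R = λ i j → R (suc i) (suc j)} (P? ∘ suc) (λ i j → R? (suc i) (suc j)) total tr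
  ... | no ¬p | inj₁ none = inj₁ λ { zero → ¬p ; (suc i) → none i }
  ... | no ¬p | inj₂ (i , pᵢ , max) = inj₂ (suc i , pᵢ ,
      λ { zero p → contradiction p ¬p ; (suc j) p → max j p })
  ... | yes p | inj₁ none = inj₂ (zero , p ,
      λ { zero _ → total⇒refl {R = R} (R? zero zero) total ; (suc j) q → contradiction q (none j) })
  ... | yes p | inj₂ (i , pᵢ , max) with R? zero (suc i)
  ...   | yes r = inj₂ (suc i , pᵢ , λ { zero _ → r ; (suc j) q → max j q })
  ...   | no ¬r = inj₂ (zero , p , λ { zero _ → total⇒refl {R = R} (R? zero zero) total ; (suc j) q → tr (max j q) (total ¬r) })

  -- The combinatorial core, free of geometry: `t ≤[ s ] t′` stands for "t is no farther from s than
  -- t′", and `φ i j k`, `ψ i j k` for a + bc and a + bc′, where i, j, k index a, b, c.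
  module _ {m n p : ℕ} (_≤[_]_ : Fin m → Fin m → Fin m → Set)
    (_≤?[_]_ : ∀ t s t′ → Dec (t ≤[ s ] t′))
    (total : ∀ {s t t′} → ¬ t ≤[ s ] t′ → t′ ≤[ s ] t)
    (tr : ∀ {s t t′ t″} → t ≤[ s ] t′ → t′ ≤[ s ] t″ → t ≤[ s ] t″)
    (φ ψ : Fin n → Fin p → Fin n → Fin m)
    (inj : ∀ k {i j i′ j′} → φ i j k ≡ φ i′ j′ k → ψ i j k ≡ ψ i′ j′ k → i ≡ i′ × j ≡ j′)
    (K : ℕ) {{K≢0 : ℕ.NonZero K}} {{m≢0 : ℕ.NonZero m}}
    (multiplicity : ∀ i j t → count (λ k → t ≤?[ φ i j k ] ψ i j k) ≤ K) where

    ball : Fin m → Fin m → ℕ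
    ball s s′ = count (λ t → t ≤?[ s ] s′)

    -- A disc is small if it has at most 2Km/n points, twice the bound Km/n on the mean over k.
    -- Everything is multiplied by n to stay in ℕ.
    T : ℕ
    T = 2 * (K * m)

    T≢0 : ℕ.NonZero T
    T≢0 = ℕ.m*n≢0 2 (K * m) {{_}} {{ℕ.m*n≢0 K m {{K≢0}} {{m≢0}}}}

    small? : ∀ s s′ → Dec (n * ball s s′ ≤ T)
    small? s s′ = n * ball s s′ ℕ.≤? T

    -- Discs about one centre are nested, so every s′ on the boundary of a small disc lies in the
    -- largest small disc, which is itself small.
    balls-at : ∀ s → n * count (small? s) ≤ T
    balls-at s with maximum {R = λ t t′ → t ≤[ s ] t′} (small? s) (λ t t′ → t ≤?[ s ] t′) total tr
    ... | inj₁ none = begin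
      n * count (small? s)   ≤⟨ ℕ.*-monoʳ-≤ n (sum-mono λ i → ℕ.≤-reflexive (vanish i)) ⟩
      n * (∑[ i < m ] 0)     ≡⟨ cong (n *_) (trans (sum-const m 0) (ℕ.*-zeroʳ m)) ⟩
      n * 0                  ≡⟨ ℕ.*-zeroʳ n ⟩
      0                      ≤⟨ z≤n ⟩
      T                      ∎
      where
      vanish : ∀ i → 𝟙 (small? s i) ≡ 0
      vanish i with small? s i
      ... | yes q = contradiction q (none i)
      ... | no  _ = refl
    ... | inj₂ (i , small , max) = begin
      n * count (small? s)   ≤⟨ ℕ.*-monoʳ-≤ n (sum-mono λ j → 𝟙-mono (small? s j) (j ≤?[ s ] i) (max j)) ⟩
      n * ball s i           ≤⟨ small ⟩
      T                      ∎

    -- Markov's inequality: for fixed i and j the discs have at most mK points in total, so at most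
    -- half of them can exceed twice the mean bound.
    small-balls : ∀ i j → n ≤ 2 * count (λ k → small? (φ i j k) (ψ i j k))
    -- After doubling, the total mK accounts for exactly one copy of `n * T`; this copy cancels, and
    -- then so does the factor `T`.
    small-balls i j = ℕ.*-cancelˡ-≤ T {{T≢0}} (ℕ.+-cancelˡ-≤ (n * T) (T * n) _ (begin
      n * T + T * n                          ≡⟨ double n T ⟩
      2 * (n * T)                            ≤⟨ ℕ.*-monoʳ-≤ 2 (≤sum pointwise) ⟩
      2 * ∑[ k < n ] (n * N k + T * g k)     ≡⟨ cong (2 *_) (trans (∑-distrib-+ (λ k → n * N k) (λ k → T * g k))
                                                  (sym (cong₂ _+_ (*-distribˡ-sum n N) (*-distribˡ-sum T g)))) ⟩
      2 * (n * sum N + T * G)                ≤⟨ ℕ.*-monoʳ-≤ 2 (ℕ.+-monoˡ-≤ (T * G) (ℕ.*-monoʳ-≤ n sumN≤)) ⟩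
      2 * (n * (m * K) + T * G)              ≡⟨ expand n m K G ⟩
      n * T + T * (2 * G)                    ∎))
      where
      N g : Fin n → ℕ
      N k = ball (φ i j k) (ψ i j k)
      g k = 𝟙 (small? (φ i j k) (ψ i j k))
      G = sum g
      double : ∀ n T → n * T + T * n ≡ 2 * (n * T)
      double = solve-∀
      expand : ∀ n m K G →
        2 * (n * (m * K) + 2 * (K * m) * G) ≡ n * (2 * (K * m)) + 2 * (K * m) * (2 * G)
      expand = solve-∀
      -- The indicator supplies `T` for a small disc; for any other disc the number of points does.
      pointwise : ∀ k → T ≤ n * N k + T * g k
      pointwise k with small? (φ i j k) (ψ i j k)
      ... | yes _ = ℕ.≤-trans (ℕ.≤-reflexive (sym (ℕ.*-identityʳ T))) (ℕ.m≤n+m (T * 1) (n * N k))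
      ... | no ¬q = ℕ.≤-trans (ℕ.<⇒≤ (ℕ.≰⇒> ¬q)) (ℕ.m≤m+n (n * N k) (T * 0))
      sumN≤ : sum N ≤ m * K
      sumN≤ = begin
        sum N                                       ≡⟨ ∑-comm (λ k t → 𝟙 (t ≤?[ φ i j k ] ψ i j k)) ⟩
        ∑[ t < m ] count (λ k → t ≤?[ φ i j k ] ψ i j k)  ≤⟨ sum≤ (multiplicity i j) ⟩
        m * K                                       ∎

    -- The triples with a small disc are counted twice: from below by `small-balls` for each (i, j),
    -- from above by `balls-at` for each k and s.
    nearest-triples-≤ : n * (p * n) ≤ 4 * (K * (m * m))
    nearest-triples-≤ = begin
      n * (p * n)
        ≤⟨ ≤sum (λ i → ≤sum (small-balls i)) ⟩
      ∑[ i < n ] ∑[ j < p ] (2 * (∑[ k < n ] g i j k))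
        ≡⟨ sum-cong-≗ (λ i → *-distribˡ-sum 2 (λ j → ∑[ k < n ] g i j k)) ⟨
      ∑[ i < n ] (2 * (∑[ j < p ] ∑[ k < n ] g i j k))
        ≡⟨ *-distribˡ-sum 2 (λ i → ∑[ j < p ] ∑[ k < n ] g i j k) ⟨
      2 * (∑[ i < n ] ∑[ j < p ] ∑[ k < n ] g i j k)
        -- k moves outermost because a pair (s, s′) determines (i, j) only once k is fixed.
        ≡⟨ cong (2 *_) (∑∑-comm g) ⟩
      2 * (∑[ k < n ] ∑[ i < n ] ∑[ j < p ] g i j k)
        ≤⟨ ℕ.*-monoʳ-≤ 2 (sum≤ (λ k → sum-injective-≤ (λ i j → φ i j k) (λ i j → ψ i j k) (inj k)
             (λ s s′ → 𝟙 (small? s s′)))) ⟩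
      2 * (n * (∑[ s < m ] count (small? s)))
        ≡⟨ cong (2 *_) (*-distribˡ-sum n (λ s → count (small? s))) ⟩
      2 * (∑[ s < m ] (n * count (small? s)))
        ≤⟨ ℕ.*-monoʳ-≤ 2 (sum≤ balls-at) ⟩
      2 * (m * T)
        ≡⟨ collect m K ⟩
      4 * (K * (m * m)) ∎
      where
      g : Fin n → Fin p → Fin n → ℕ
      g i j k = 𝟙 (small? (φ i j k) (ψ i j k))
      collect : ∀ m K → 2 * (m * (2 * (K * m))) ≡ 4 * (K * (m * m))
      collect = solve-∀

open import Defs

-- Order and arithmetic of ℝ

-- Reduces algebraic identities between reals to the rational ring solver at each index.
pointwise : ∀ {x y} → (∀ n → seq x n ≡ seq y n) → x ≃ y
pointwise {x} {y} e = mk≃ λ {ε} 0<ε → 0 , λ n _ →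
  subst (λ q → ∣ seq x n ℚ.- q ∣ ℚ.< ε) (e n) (∣p-p∣<ε (seq x n) 0<ε)

≃⇒≤ : ∀ {x y} → x ≃ y → x ≤ y
≃⇒≤ {x} {y} p = mk≤ λ {ε} 0<ε →
  let N , f = ≃-close p 0<ε in N , λ n a → p<q+ε {seq x n} {seq y n} {ε} (f n a)

≤-refl : ∀ {x} → x ≤ x
≤-refl = ≃⇒≤ ≃-refl

≤-trans : ∀ {x y z} → x ≤ y → y ≤ z → x ≤ z
≤-trans {x} {y} {z} p q = mk≤ λ {ε} 0<ε →
  let M , f = ≤-close p (0<* 0<½ 0<ε)
      N , g = ≤-close q (0<* 0<½ 0<ε)
  in M ℕ.⊔ N , λ n a → ℚ.<-trans (f n (ℕ.m⊔n≤o⇒m≤o M N a))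
       (subst (seq y n ℚ.+ ½ ℚ.* ε ℚ.<_)
         (trans (ℚ.+-assoc (seq z n) (½ ℚ.* ε) (½ ℚ.* ε)) (cong (seq z n ℚ.+_) (½+½ ε)))
         (ℚ.+-monoˡ-< (½ ℚ.* ε) (g n (ℕ.m⊔n≤o⇒n≤o M N a))))

≤-antisym : ∀ {x y} → x ≤ y → y ≤ x → x ≃ y
≤-antisym {x} {y} p q = mk≃ λ {ε} 0<ε →
  let M , f = ≤-close p 0<ε
      N , g = ≤-close q 0<ε
  in M ℕ.⊔ N , λ n a → ∣p-q∣<ε {seq x n} {seq y n} {ε}
       (f n (ℕ.m⊔n≤o⇒m≤o M N a)) (g n (ℕ.m⊔n≤o⇒n≤o M N a))

<⇒≤ : ∀ {x y} → x < y → x ≤ y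
<⇒≤ {x} {y} (mk< g 0<g (N , f)) = mk≤ λ {ε} 0<ε → N , λ n a →
  ℚ.<-trans (subst (ℚ._< seq x n ℚ.+ g) (ℚ.+-identityʳ (seq x n)) (ℚ.+-monoʳ-< (seq x n) 0<g))
    (ℚ.<-trans (f n a) (subst (ℚ._< seq y n ℚ.+ ε) (ℚ.+-identityʳ (seq y n)) (ℚ.+-monoʳ-< (seq y n) 0<ε)))

<⇒≱ : ∀ {x y} → x < y → ¬ y ≤ x
<⇒≱ {x} {y} (mk< g 0<g (M , f)) p =
  let N , h = ≤-close p 0<g
  in ℚ.<-asym (f (M ℕ.⊔ N) (ℕ.m≤m⊔n M N)) (h (M ℕ.⊔ N) (ℕ.m≤n⊔m M N))

-- With both sequences settled to within η = ε/5, one comparison at a single index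
-- separates y < x from x < y + ε; this makes _≤_ stable under double negation.
≮⇒≥ : ∀ {x y} → ¬ y < x → x ≤ y
≮⇒≥ {x} {y} y≮x = mk≤ λ {ε} 0<ε →
  let η , 0<η , 5η≡ε = shrink (0<fromℕℚ 4) 0<ε
      M , f = toOneSided {seq x} (cauchy x) 0<η
      N , g = toOneSided {seq y} (cauchy y) 0<η
      K = M ℕ.⊔ N
      M≤ = λ n (a : M ℕ.⊔ N ℕ.≤ n) → ℕ.m⊔n≤o⇒m≤o M N a
      N≤ = λ n (a : M ℕ.⊔ N ℕ.≤ n) → ℕ.m⊔n≤o⇒n≤o M N a
  in K , λ n a → case ε η K 0<η 5η≡ε
       (λ k b → f k K (M≤ k b) (ℕ.m≤m⊔n M N)) (λ k b → f K k (ℕ.m≤m⊔n M N) (M≤ k b))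
       (λ k b → g k K (N≤ k b) (ℕ.m≤n⊔m M N)) (λ k b → g K k (ℕ.m≤n⊔m M N) (N≤ k b)) n a
  where
  open ℚ.≤-Reasoning
  case : ∀ ε η K → 0ℚ ℚ.< η → fromℕℚ 5 ℚ.* η ≡ ε →
    (∀ n → K ℕ.≤ n → seq x n ℚ.< seq x K ℚ.+ η) → (∀ n → K ℕ.≤ n → seq x K ℚ.< seq x n ℚ.+ η) →
    (∀ n → K ℕ.≤ n → seq y n ℚ.< seq y K ℚ.+ η) → (∀ n → K ℕ.≤ n → seq y K ℚ.< seq y n ℚ.+ η) →
    ∀ n → K ℕ.≤ n → seq x n ℚ.< seq y n ℚ.+ ε
  case ε η K 0<η 5η≡ε xₙ<xₖ xₖ<xₙ yₙ<yₖ yₖ<yₙ n K≤n with seq x K ℚ.<? seq y K ℚ.+ fromℕℚ 3 ℚ.* η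
  ... | yes l = begin-strict
    seq x n                                    <⟨ xₙ<xₖ n K≤n ⟩
    seq x K ℚ.+ η                              <⟨ ℚ.+-monoˡ-< η l ⟩
    seq y K ℚ.+ fromℕℚ 3 ℚ.* η ℚ.+ η           <⟨ ℚ.+-monoˡ-< η (ℚ.+-monoˡ-< (fromℕℚ 3 ℚ.* η) (yₖ<yₙ n K≤n)) ⟩
    seq y n ℚ.+ η ℚ.+ fromℕℚ 3 ℚ.* η ℚ.+ η     ≡⟨ solve 2 (λ y η → y :+ η :+ con (fromℕℚ 3) :* η :+ η
                                                    := y :+ con (fromℕℚ 5) :* η) refl (seq y n) η ⟩
    seq y n ℚ.+ fromℕℚ 5 ℚ.* η                 ≡⟨ cong (seq y n ℚ.+_) 5η≡ε ⟩
    seq y n ℚ.+ ε                              ∎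
  ... | no ¬l = contradiction (mk< η 0<η (K , λ k K≤k → begin-strict
    seq y k ℚ.+ η                              <⟨ ℚ.+-monoˡ-< η (yₙ<yₖ k K≤k) ⟩
    seq y K ℚ.+ η ℚ.+ η                        ≡⟨ solve 2 (λ y η → y :+ η :+ η
                                                    := y :+ con (fromℕℚ 3) :* η :- η) refl (seq y K) η ⟩
    seq y K ℚ.+ fromℕℚ 3 ℚ.* η ℚ.- η           ≤⟨ ℚ.+-monoˡ-≤ (ℚ.- η) (ℚ.≮⇒≥ ¬l) ⟩
    seq x K ℚ.- η                              <⟨ ℚ.+-monoˡ-< (ℚ.- η) (xₖ<xₙ k K≤k) ⟩
    seq x k ℚ.+ η ℚ.- η                        ≡⟨ solve 2 (λ x η → x :+ η :- η := x) refl (seq x k) η ⟩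
    seq x k                                    ∎)) y≮x

-- The form of totality that `maximum` and the disc count require; it holds without deciding the
-- order.
≰⇒≥ : ∀ {x y} → ¬ x ≤ y → y ≤ x
≰⇒≥ x≰y = ≮⇒≥ λ x<y → x≰y (<⇒≤ x<y)

+-mono-≤ : ∀ {x x′ y y′} → x ≤ x′ → y ≤ y′ → x + y ≤ x′ + y′
+-mono-≤ {x} {x′} {y} {y′} p q = mk≤ λ {ε} 0<ε →
  let M , f = ≤-close p (0<* 0<½ 0<ε)
      N , g = ≤-close q (0<* 0<½ 0<ε)
  in M ℕ.⊔ N , λ n a → +-½-mono {seq x n} {seq x′ n} {seq y n} {seq y′ n} {ε}
       (f n (ℕ.m⊔n≤o⇒m≤o M N a)) (g n (ℕ.m⊔n≤o⇒n≤o M N a))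

+-cong : ∀ {x x′ y y′} → x ≃ x′ → y ≃ y′ → x + y ≃ x′ + y′
+-cong p q = ≤-antisym (+-mono-≤ (≃⇒≤ p) (≃⇒≤ q)) (+-mono-≤ (≃⇒≤ (≃-sym p)) (≃⇒≤ (≃-sym q)))

neg-cong : ∀ {x y} → x ≃ y → - x ≃ - y
neg-cong {x} {y} p = mk≃ λ {ε} 0<ε → let N , f = ≃-close (≃-sym p) 0<ε in N , λ n a →
  subst (ℚ._< ε) (∣-∣-neg (seq x n) (seq y n)) (f n a)

-‿cong : ∀ {x x′ y y′} → x ≃ x′ → y ≃ y′ → x - y ≃ x′ - y′
-‿cong p q = +-cong p (neg-cong q)

*-cong : ∀ {x x′ y y′} → x ≃ x′ → y ≃ y′ → x * y ≃ x′ * y′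
*-cong {x} {x′} {y} {y′} p q = mk≃ λ {ε} 0<ε →
  let B , 0<B , L , bx = bounded x
      C , 0<C , M , by = bounded y′
      η , 0<η , eq     = shrink (0<+ 0<B 0<C) 0<ε
      P , f            = ≃-close p 0<η
      Q , g            = ≃-close q 0<η
  in (L ℕ.⊔ M) ℕ.⊔ (P ℕ.⊔ Q) , λ n a →
     let a₁ = ℕ.m⊔n≤o⇒m≤o (L ℕ.⊔ M) (P ℕ.⊔ Q) a ; a₂ = ℕ.m⊔n≤o⇒n≤o (L ℕ.⊔ M) (P ℕ.⊔ Q) a
     in subst (∣ seq x n ℚ.* seq y n ℚ.- seq x′ n ℚ.* seq y′ n ∣ ℚ.<_) eq
          (*-close (seq x n) (seq y n) (seq x′ n) (seq y′ n) 0<η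
            (bx n (ℕ.m⊔n≤o⇒m≤o L M a₁)) (by n (ℕ.m⊔n≤o⇒n≤o L M a₁))
            (f n (ℕ.m⊔n≤o⇒m≤o P Q a₂)) (g n (ℕ.m⊔n≤o⇒n≤o P Q a₂)))

x≤y⇒0≤y-x : ∀ {x y} → x ≤ y → 0ℝ ≤ y - x
x≤y⇒0≤y-x {x} {y} p = ≤-trans (≃⇒≤ (pointwise λ n → sym (ℚ.+-inverseʳ (seq x n))))
  (+-mono-≤ {x} {y} { - x } { - x } p ≤-refl)

0≤y-x⇒x≤y : ∀ {x y} → 0ℝ ≤ y - x → x ≤ y
0≤y-x⇒x≤y {x} {y} p = ≤-trans (≃⇒≤ (pointwise λ n → sym (ℚ.+-identityˡ (seq x n))))
  (≤-trans (+-mono-≤ {0ℝ} {y - x} {x} {x} p ≤-refl)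
    (≃⇒≤ (pointwise λ n → solve 2 (λ x y → y :- x :+ x := y) refl (seq x n) (seq y n))))

0≤+0≤ : ∀ {x y} → 0ℝ ≤ x → 0ℝ ≤ y → 0ℝ ≤ x + y
0≤+0≤ {x} {y} p q = ≤-trans (≃⇒≤ (pointwise λ _ → refl)) (+-mono-≤ {0ℝ} {x} {0ℝ} {y} p q)

0<*0< : ∀ {x y} → 0ℝ < x → 0ℝ < y → 0ℝ < x * y
0<*0< {x} {y} (mk< g 0<g (M , f)) (mk< h 0<h (N , k)) =
  mk< (½ ℚ.* (g ℚ.* h)) (0<* 0<½ (0<* 0<g 0<h)) (M ℕ.⊔ N , λ n a →
    ℚ.<-≤-trans (½p<p (0<* 0<g 0<h)) (*-mono-≤ (ℚ.<⇒≤ 0<g)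
      (ℚ.<⇒≤ (subst (ℚ._< seq x n) (ℚ.+-identityˡ g) (f n (ℕ.m⊔n≤o⇒m≤o M N a)))) (ℚ.<⇒≤ 0<h)
      (ℚ.<⇒≤ (subst (ℚ._< seq y n) (ℚ.+-identityˡ h) (k n (ℕ.m⊔n≤o⇒n≤o M N a))))))

-- `¬ x ≤ 0ℝ` carries no explicit gap, but as a contradiction is sought, two uses of `≮⇒≥` allow x
-- and y to be taken positive.
≰0*≰0⇒≰0 : ∀ {x y} → ¬ x ≤ 0ℝ → ¬ y ≤ 0ℝ → ¬ x * y ≤ 0ℝ
≰0*≰0⇒≰0 x≰0 y≰0 xy≤0 =
  x≰0 (≮⇒≥ λ 0<x → y≰0 (≮⇒≥ λ 0<y → <⇒≱ (0<*0< 0<x 0<y) xy≤0))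

-- Suppose xy < 0. A positive x would force y ≤ 0, hence y ≃ 0 and xy ≃ 0; so x ≤ 0, hence x ≃ 0 and
-- again xy ≃ 0.
0≤*0≤ : ∀ {x y} → 0ℝ ≤ x → 0ℝ ≤ y → 0ℝ ≤ x * y
0≤*0≤ {x} {y} 0≤x 0≤y = ≮⇒≥ λ xy<0 →
  let vanish : x * y ≃ 0ℝ → _
      vanish e = <⇒≱ {x * y} {0ℝ} xy<0 (≃⇒≤ {0ℝ} {x * y} (≃-sym {x * y} {0ℝ} e))
      y≤0 : 0ℝ < x → y ≤ 0ℝ
      y≤0 0<x = ≮⇒≥ λ 0<y → <⇒≱ {x * y} {0ℝ} xy<0 (<⇒≤ {0ℝ} {x * y} (0<*0< 0<x 0<y))
      x≤0 : x ≤ 0ℝ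
      x≤0 = ≮⇒≥ λ 0<x → vanish (≃-trans {x * y} {x * 0ℝ} {0ℝ}
        (*-cong {x} {x} {y} {0ℝ} ≃-refl (≤-antisym (y≤0 0<x) 0≤y))
        (pointwise {x * 0ℝ} {0ℝ} λ n → ℚ.*-zeroʳ (seq x n)))
  in vanish (≃-trans {x * y} {0ℝ * y} {0ℝ} (*-cong {x} {0ℝ} {y} {y} (≤-antisym x≤0 0≤x) ≃-refl)
       (pointwise {0ℝ * y} {0ℝ} λ n → ℚ.*-zeroˡ (seq y n)))

-- The hypothesis has the shape delivered by `bit≡⇒`; in the negative case both factors change sign.
same-sign : ∀ {x y} → (0ℝ ≤ x × 0ℝ ≤ y) ⊎ (¬ 0ℝ ≤ x × ¬ 0ℝ ≤ y) → 0ℝ ≤ x * y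
same-sign (inj₁ (p , q)) = 0≤*0≤ p q
same-sign {x} {y} (inj₂ (p , q)) = ≤-trans {0ℝ} {(0ℝ - x) * (0ℝ - y)} {x * y}
  (0≤*0≤ {0ℝ - x} {0ℝ - y} (x≤y⇒0≤y-x {x} {0ℝ} (≰⇒≥ p)) (x≤y⇒0≤y-x {y} {0ℝ} (≰⇒≥ q)))
  (≃⇒≤ (pointwise {(0ℝ - x) * (0ℝ - y)} {x * y} λ n →
    solve 2 (λ x y → (con 0ℚ :- x) :* (con 0ℚ :- y) := x :* y) refl (seq x n) (seq y n)))

*-monoˡ-≤ : ∀ {x y z} → 0ℝ ≤ z → x ≤ y → z * x ≤ z * y
*-monoˡ-≤ {x} {y} {z} 0≤z x≤y = 0≤y-x⇒x≤y (≤-trans (0≤*0≤ 0≤z (x≤y⇒0≤y-x x≤y))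
  (≃⇒≤ (pointwise λ n → solve 3 (λ x y z → z :* (y :- x) := z :* y :- z :* x) refl
    (seq x n) (seq y n) (seq z n))))

0≤p*p : ∀ p → 0ℚ ℚ.≤ p ℚ.* p
0≤p*p p = subst (0ℚ ℚ.≤_) (sym (∣p∣²≡p² p)) (0≤* (ℚ.0≤∣p∣ p) (ℚ.0≤∣p∣ p))
  where
  ∣p∣²≡p² : ∀ p → p ℚ.* p ≡ ∣ p ∣ ℚ.* ∣ p ∣
  ∣p∣²≡p² p with ℚ.∣p∣≡p∨∣p∣≡-p p
  ... | inj₁ e = sym (cong₂ ℚ._*_ e e)
  ... | inj₂ e = trans (solve 1 (λ p → p :* p := (:- p) :* (:- p)) refl p) (sym (cong₂ ℚ._*_ e e))

square<⇒∣∣< : ∀ {p ε} → 0ℚ ℚ.< ε → p ℚ.* p ℚ.< ε ℚ.* ε → ∣ p ∣ ℚ.< ε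
square<⇒∣∣< {p} {ε} 0<ε l = square-<⇒< {∣ p ∣} {ε} (ℚ.<⇒≤ 0<ε)
  (subst (ℚ._< ε ℚ.* ε) (trans (sym (ℚ.0≤p⇒∣p∣≡p (0≤p*p p))) (ℚ.∣p*q∣≡∣p∣*∣q∣ p p)) l)

0≤fromℕ : ∀ n → 0ℝ ≤ fromℕ n
0≤fromℕ n = mk≤ λ {ε} 0<ε → 0 , λ _ _ →
  subst (ℚ._< fromℕℚ n ℚ.+ ε) (ℚ.+-identityˡ 0ℚ) (ℚ.+-mono-≤-< {0ℚ} {fromℕℚ n} {0ℚ} {ε} (0≤fromℕℚ n) 0<ε)

-- Squared distances in ℂ

p≤p+q : ∀ p {q} → 0ℚ ℚ.≤ q → p ℚ.≤ p ℚ.+ q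
p≤p+q p {q} 0≤q = subst (ℚ._≤ p ℚ.+ q) (ℚ.+-identityʳ p) (ℚ.+-monoʳ-≤ p 0≤q)

q≤p+q : ∀ {p} q → 0ℚ ℚ.≤ p → q ℚ.≤ p ℚ.+ q
q≤p+q {p} q 0≤p = subst (ℚ._≤ p ℚ.+ q) (ℚ.+-identityˡ q) (ℚ.+-monoˡ-≤ q 0≤p)

-- Recovers a coordinate from a squared distance `s`: the index at which `s` falls below ε² serves
-- for ε.
close-of-squares : ∀ {x u} (s : ℕ → ℚ) →
  (∀ n → (seq x n ℚ.- seq u n) ℚ.* (seq x n ℚ.- seq u n) ℚ.≤ s n) →
  (∀ {ε} → 0ℚ ℚ.< ε → ∃[ N ] (∀ n → N ℕ.≤ n → s n ℚ.< 0ℚ ℚ.+ ε)) → x ≃ u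
close-of-squares s h c = mk≃ λ {ε} 0<ε → let N , f = c (0<* 0<ε 0<ε) in N , λ n a →
  square<⇒∣∣< 0<ε (ℚ.≤-<-trans (h n) (subst (s n ℚ.<_) (ℚ.+-identityˡ (ε ℚ.* ε)) (f n a)))

0ᶜ : ℂ
0ᶜ = 0ℝ +i 0ℝ

-- Abstract, since otherwise unification unfolds products of reals down to their Cauchy
-- moduli, which is prohibitively slow.
abstract
  dist² : ℂ → ℂ → ℝ
  dist² z w = (re z - re w) * (re z - re w) + (im z - im w) * (im z - im w)

  square-‿cong : ∀ {x x′ u u′} → x ≃ x′ → u ≃ u′ → (x - u) * (x - u) ≃ (x′ - u′) * (x′ - u′)
  square-‿cong {x} {x′} {u} {u′} p q = *-cong {x - u} {x′ - u′} {x - u} {x′ - u′}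
    (-‿cong {x} {x′} {u} {u′} p q) (-‿cong {x} {x′} {u} {u′} p q)

  dist²-cong : ∀ {z z′ w w′} → z ≈ z′ → w ≈ w′ → dist² z w ≃ dist² z′ w′
  dist²-cong {x +i y} {x′ +i y′} {u +i v} {u′ +i v′} (p , q) (r , s) =
    +-cong {(x - u) * (x - u)} {(x′ - u′) * (x′ - u′)} {(y - v) * (y - v)} {(y′ - v′) * (y′ - v′)}
      (square-‿cong {x} {x′} {u} {u′} p r) (square-‿cong {y} {y′} {v} {v′} q s)

  dist²-sym : ∀ z w → dist² z w ≃ dist² w z
  dist²-sym z w = pointwise {dist² z w} {dist² w z} λ n → solve 4 (λ x y u v →
    (x :- u) :* (x :- u) :+ (y :- v) :* (y :- v) := (u :- x) :* (u :- x) :+ (v :- y) :* (v :- y))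
    refl (seq (re z) n) (seq (im z) n) (seq (re w) n) (seq (im w) n)

  0≤dist² : ∀ z w → 0ℝ ≤ dist² z w
  0≤dist² z w = 0≤+0≤ {(re z - re w) * (re z - re w)} {(im z - im w) * (im z - im w)}
    (0≤x*x (re z - re w)) (0≤x*x (im z - im w))
    where
    0≤x*x : ∀ x → 0ℝ ≤ x * x
    0≤x*x x = mk≤ λ {ε} 0<ε → 0 , λ n _ →
      subst (ℚ._< seq x n ℚ.* seq x n ℚ.+ ε) (ℚ.+-identityˡ 0ℚ)
        (ℚ.+-mono-≤-< {0ℚ} {seq x n ℚ.* seq x n} {0ℚ} {ε} (0≤p*p (seq x n)) 0<ε)

  dist²≤0⇒≈ : ∀ {z w} → dist² z w ≤ 0ℝ → z ≈ w
  dist²≤0⇒≈ {z} {w} p =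
      close-of-squares {re z} {re w} (seq (dist² z w)) (λ n → p≤p+q _ (0≤p*p (seq (im z) n ℚ.- seq (im w) n))) (≤-close p)
    , close-of-squares {im z} {im w} (seq (dist² z w)) (λ n → q≤p+q _ (0≤p*p (seq (re z) n ℚ.- seq (re w) n))) (≤-close p)

  dist²-refl : ∀ z → dist² z z ≃ 0ℝ
  dist²-refl z = pointwise {dist² z z} {0ℝ} λ n → solve 2 (λ x y →
    (x :- x) :* (x :- x) :+ (y :- y) :* (y :- y) := con 0ℚ) refl (seq (re z) n) (seq (im z) n)

  -- The translation cancels and the norm is multiplicative: |b(c - c′)|² = |b|²|c - c′|².
  dist²-affine : ∀ a b c c′ → dist² (a +ᶜ b *ᶜ c) (a +ᶜ b *ᶜ c′) ≃ dist² b 0ᶜ * dist² c c′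
  dist²-affine (a +i a′) (b +i b′) (c +i c′) (d +i d′) = pointwise
    {dist² ((a +i a′) +ᶜ (b +i b′) *ᶜ (c +i c′)) ((a +i a′) +ᶜ (b +i b′) *ᶜ (d +i d′))}
    {dist² (b +i b′) 0ᶜ * dist² (c +i c′) (d +i d′)} λ n → solve 8
    (λ a a′ b b′ c c′ d d′ →
      (a :+ (b :* c :- b′ :* c′) :- (a :+ (b :* d :- b′ :* d′))) :*
      (a :+ (b :* c :- b′ :* c′) :- (a :+ (b :* d :- b′ :* d′))) :+
      (a′ :+ (b :* c′ :+ b′ :* c) :- (a′ :+ (b :* d′ :+ b′ :* d))) :*
      (a′ :+ (b :* c′ :+ b′ :* c) :- (a′ :+ (b :* d′ :+ b′ :* d)))
      := ((b :- con 0ℚ) :* (b :- con 0ℚ) :+ (b′ :- con 0ℚ) :* (b′ :- con 0ℚ)) :*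
         ((c :- d) :* (c :- d) :+ (c′ :- d′) :* (c′ :- d′))) refl
    (seq a n) (seq a′ n) (seq b n) (seq b′ n) (seq c n) (seq c′ n) (seq d n) (seq d′ n)

  +ᶜ-cong : ∀ {z z′ w w′} → z ≈ z′ → w ≈ w′ → z +ᶜ w ≈ z′ +ᶜ w′
  +ᶜ-cong {x +i y} {x′ +i y′} {u +i v} {u′ +i v′} (p , q) (r , s) =
    +-cong {x} {x′} {u} {u′} p r , +-cong {y} {y′} {v} {v′} q s

  *ᶜ-congʳ : ∀ {z z′} w → z ≈ z′ → z *ᶜ w ≈ z′ *ᶜ w
  *ᶜ-congʳ {x +i y} {x′ +i y′} (u +i v) (p , q) =
      -‿cong {x * u} {x′ * u} {y * v} {y′ * v} (*-cong {x} {x′} {u} {u} p ≃-refl) (*-cong {y} {y′} {v} {v} q ≃-refl)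
    , +-cong {x * v} {x′ * v} {y * u} {y′ * u} (*-cong {x} {x′} {v} {v} p ≃-refl) (*-cong {y} {y′} {u} {u} q ≃-refl)

  +ᶜ-cancelʳ : ∀ {a a′ w w′} → w ≈ w′ → a +ᶜ w ≈ a′ +ᶜ w′ → a ≈ a′
  +ᶜ-cancelʳ {x +i y} {x′ +i y′} {u +i v} {u′ +i v′} (r , s) (p , q) =
    cancel {x} {x′} {u} {u′} r p , cancel {y} {y′} {v} {v′} s q
    where
    cancel : ∀ {x x′ u u′} → u ≃ u′ → x + u ≃ x′ + u′ → x ≃ x′
    cancel {x} {x′} {u} {u′} r p = ≃-trans {x} {x + u - u} {x′}
      (pointwise {x} {x + u - u} λ n → solve 2 (λ x u → x := x :+ u :- u) refl (seq x n) (seq u n))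
      (≃-trans {x + u - u} {x′ + u′ - u′} {x′} (-‿cong {x + u} {x′ + u′} {u} {u′} p r)
        (pointwise {x′ + u′ - u′} {x′} λ n → solve 2 (λ x u → x :+ u :- u := x) refl (seq x′ n) (seq u′ n)))

  -- (a + bc) + (a′ + b′c′) − (a′ + b′c) − (a + bc′) = (b − b′)(c − c′)
  dist²-cross : ∀ a b a′ b′ c c′ → dist² b b′ * dist² c c′ ≃
    dist² ((a +ᶜ b *ᶜ c) +ᶜ (a′ +ᶜ b′ *ᶜ c′)) ((a′ +ᶜ b′ *ᶜ c) +ᶜ (a +ᶜ b *ᶜ c′))
  dist²-cross a b a′ b′ c c′ = pointwise {dist² b b′ * dist² c c′}
    {dist² ((a +ᶜ b *ᶜ c) +ᶜ (a′ +ᶜ b′ *ᶜ c′)) ((a′ +ᶜ b′ *ᶜ c) +ᶜ (a +ᶜ b *ᶜ c′))} λ n → solve 12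
    (λ a₁ a₂ b₁ b₂ x₁ x₂ y₁ y₂ c₁ c₂ d₁ d₂ →
      let u = (a₁ :+ (b₁ :* c₁ :- b₂ :* c₂)) :+ (x₁ :+ (y₁ :* d₁ :- y₂ :* d₂))
              :- ((x₁ :+ (y₁ :* c₁ :- y₂ :* c₂)) :+ (a₁ :+ (b₁ :* d₁ :- b₂ :* d₂)))
          v = (a₂ :+ (b₁ :* c₂ :+ b₂ :* c₁)) :+ (x₂ :+ (y₁ :* d₂ :+ y₂ :* d₁))
              :- ((x₂ :+ (y₁ :* c₂ :+ y₂ :* c₁)) :+ (a₂ :+ (b₁ :* d₂ :+ b₂ :* d₁)))
      in ((b₁ :- y₁) :* (b₁ :- y₁) :+ (b₂ :- y₂) :* (b₂ :- y₂)) :*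
         ((c₁ :- d₁) :* (c₁ :- d₁) :+ (c₂ :- d₂) :* (c₂ :- d₂))
         := u :* u :+ v :* v) refl
    (seq (re a) n) (seq (im a) n) (seq (re b) n) (seq (im b) n) (seq (re a′) n) (seq (im a′) n)
    (seq (re b′) n) (seq (im b′) n) (seq (re c) n) (seq (im c) n) (seq (re c′) n) (seq (im c′) n)

  -- The signs of `Δre` and `Δim` give the quadrant of z around p; that of `Δdiag` tells which of
  -- |Δre| and |Δim| is larger. Together they describe the octant by polynomials.
  Δre Δim Δdiag : ℂ → ℂ → ℝ
  Δre p z = re z - re p
  Δim p z = im z - im p
  Δdiag p z = (re z - re p) * (re z - re p) - (im z - im p) * (im z - im p)

  -- With u = z − p, v = w − p, d = u · v, α = |v|² − 2d and β = |u|² − 2d, the same-sign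
  -- hypotheses bound the angle between u and v by 45°:
  -- − |u|²|v|² = αβ + 2d(α + β) + 2 Δdiag u Δdiag v + 8 (Δre u Δre v)(Δim u Δim v).
  sector : ∀ p z w → dist² p z ≤ dist² z w → dist² p w ≤ dist² z w →
           0ℝ ≤ Δre p z * Δre p w → 0ℝ ≤ Δim p z * Δim p w → 0ℝ ≤ Δdiag p z * Δdiag p w →
           dist² p z * dist² p w ≤ 0ℝ
  sector p z w hz hw hx hy hd = 0≤y-x⇒x≤y {dist² p z * dist² p w} {0ℝ}
    (≤-trans {0ℝ} {α * β + fromℕ 2 * (d * (α + β)) + (fromℕ 2 * D + fromℕ 8 * (X * Y))} {0ℝ - dist² p z * dist² p w}
      (0≤+0≤ {α * β + fromℕ 2 * (d * (α + β))} {fromℕ 2 * D + fromℕ 8 * (X * Y)}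
        (0≤+0≤ {α * β} {fromℕ 2 * (d * (α + β))} (0≤*0≤ {α} {β} 0≤α 0≤β)
          (0≤*0≤ {fromℕ 2} {d * (α + β)} (0≤fromℕ 2) (0≤*0≤ {d} {α + β} (0≤+0≤ {X} {Y} hx hy) (0≤+0≤ {α} {β} 0≤α 0≤β))))
        (0≤+0≤ {fromℕ 2 * D} {fromℕ 8 * (X * Y)} (0≤*0≤ {fromℕ 2} {D} (0≤fromℕ 2) hd)
          (0≤*0≤ {fromℕ 8} {X * Y} (0≤fromℕ 8) (0≤*0≤ {X} {Y} hx hy))))
      (≃⇒≤ (pointwise {α * β + fromℕ 2 * (d * (α + β)) + (fromℕ 2 * D + fromℕ 8 * (X * Y))} {0ℝ - dist² p z * dist² p w}
        λ n → solve 6 (λ p₁ p₂ z₁ z₂ w₁ w₂ →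
          let sq = λ a → a :* a
              α = sq (z₁ :- w₁) :+ sq (z₂ :- w₂) :- (sq (p₁ :- z₁) :+ sq (p₂ :- z₂))
              β = sq (z₁ :- w₁) :+ sq (z₂ :- w₂) :- (sq (p₁ :- w₁) :+ sq (p₂ :- w₂))
              X = (z₁ :- p₁) :* (w₁ :- p₁)
              Y = (z₂ :- p₂) :* (w₂ :- p₂)
              D = (sq (z₁ :- p₁) :- sq (z₂ :- p₂)) :* (sq (w₁ :- p₁) :- sq (w₂ :- p₂))
          in α :* β :+ con (fromℕℚ 2) :* ((X :+ Y) :* (α :+ β)) :+ (con (fromℕℚ 2) :* D :+ con (fromℕℚ 8) :* (X :* Y))
             := con 0ℚ :- (sq (p₁ :- z₁) :+ sq (p₂ :- z₂)) :* (sq (p₁ :- w₁) :+ sq (p₂ :- w₂))) refl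
          (seq (re p) n) (seq (im p) n) (seq (re z) n) (seq (im z) n) (seq (re w) n) (seq (im w) n))))
    where
    α β X Y D d : ℝ
    α = dist² z w - dist² p z
    β = dist² z w - dist² p w
    X = Δre p z * Δre p w
    Y = Δim p z * Δim p w
    D = Δdiag p z * Δdiag p w
    d = X + Y
    0≤α : 0ℝ ≤ α
    0≤α = x≤y⇒0≤y-x {dist² p z} {dist² z w} hz
    0≤β : 0ℝ ≤ β
    0≤β = x≤y⇒0≤y-x {dist² p w} {dist² z w} hw

≈⇒dist²≤0 : ∀ {z w} → z ≈ w → dist² z w ≤ 0ℝ
≈⇒dist²≤0 {z} {w} p = ≃⇒≤ (≃-trans (dist²-cong p ≈-refl) (dist²-refl w))

dist²-mono : ∀ {z z′ u u′ v v′} → z ≈ z′ → u ≈ u′ → v ≈ v′ → dist² z u ≤ dist² z v → dist² z′ u′ ≤ dist² z′ v′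
dist²-mono p q r l = ≤-trans (≃⇒≤ (dist²-cong (≈-sym p) (≈-sym q))) (≤-trans l (≃⇒≤ (dist²-cong p r)))

affine-mono : ∀ a b {c c′ c″} → dist² c c′ ≤ dist² c c″ →
              dist² (a +ᶜ b *ᶜ c) (a +ᶜ b *ᶜ c′) ≤ dist² (a +ᶜ b *ᶜ c) (a +ᶜ b *ᶜ c″)
affine-mono a b {c} {c′} {c″} l = ≤-trans (≃⇒≤ (dist²-affine a b c c′))
  (≤-trans (*-monoˡ-≤ {dist² c c′} {dist² c c″} {dist² b 0ᶜ} (0≤dist² b 0ᶜ) l)
    (≃⇒≤ (≃-sym (dist²-affine a b c c″))))

-- If c and c′ were apart, |b|²|c - c′|² would be a product of two positive factors.
affine-injective : ∀ a {b c c′} → ¬ dist² b 0ᶜ ≤ 0ℝ → a +ᶜ b *ᶜ c ≈ a +ᶜ b *ᶜ c′ → c ≈ c′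
affine-injective a {b} {c} {c′} b≉0 p = dist²≤0⇒≈ (≮⇒≥ λ 0<d →
  ≰0*≰0⇒≰0 {dist² b 0ᶜ} {dist² c c′} b≉0 (<⇒≱ 0<d)
    (≤-trans (≃⇒≤ (≃-sym (dist²-affine a b c c′))) (≈⇒dist²≤0 p)))

-- Two lines agreeing at two distinct abscissae coincide: `dist²-cross` gives |b - b′|²|c - c′|² ≤
-- 0, so the slopes agree, and cancellation gives the intercepts.
line-through : ∀ {a a′ b b′ c c′} → ¬ c ≈ c′ → a +ᶜ b *ᶜ c ≈ a′ +ᶜ b′ *ᶜ c →
               a +ᶜ b *ᶜ c′ ≈ a′ +ᶜ b′ *ᶜ c′ → a ≈ a′ × b ≈ b′
line-through {a} {a′} {b} {b′} {c} {c′} c≉c′ p q = +ᶜ-cancelʳ {a} {a′} {b *ᶜ c} {b′ *ᶜ c} (*ᶜ-congʳ {b} {b′} c b≈b′) p , b≈b′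
  where
  b≈b′ : b ≈ b′
  b≈b′ = dist²≤0⇒≈ (≮⇒≥ λ 0<d →
    ≰0*≰0⇒≰0 {dist² b b′} {dist² c c′} (<⇒≱ 0<d) (λ d≤0 → c≉c′ (dist²≤0⇒≈ d≤0))
      (≤-trans (≃⇒≤ (dist²-cross a b a′ b′ c c′)) (≈⇒dist²≤0 {(a +ᶜ b *ᶜ c) +ᶜ (a′ +ᶜ b′ *ᶜ c′)} {(a′ +ᶜ b′ *ᶜ c) +ᶜ (a +ᶜ b *ᶜ c′)}
        (+ᶜ-cong {a +ᶜ b *ᶜ c} {a′ +ᶜ b′ *ᶜ c} {a′ +ᶜ b′ *ᶜ c′} {a +ᶜ b *ᶜ c′} p
          (≈-sym {a +ᶜ b *ᶜ c′} {a′ +ᶜ b′ *ᶜ c′} q)))))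

-- Nearest neighbours and the multiplicity of the discs

bit : {P : Set} → Dec P → Fin 2
bit (yes _) = zero
bit (no  _) = suc zero

bit≡⇒ : {P Q : Set} (P? : Dec P) (Q? : Dec Q) → bit P? ≡ bit Q? → (P × Q) ⊎ (¬ P × ¬ Q)
bit≡⇒ (yes p) (yes q) _ = inj₁ (p , q)
bit≡⇒ (no ¬p) (no ¬q) _ = inj₂ (¬p , ¬q)

nearest : ∀ {n} (a : Fin (suc (suc n)) → ℂ) → (∀ i j k → Dec (dist² (a i) (a j) ≤ dist² (a i) (a k))) →
          ∀ i → ∃[ i′ ] (i′ ≢ i × (∀ j → j ≢ i → dist² (a i) (a i′) ≤ dist² (a i) (a j)))
-- `punchIn i zero` is an index other than `i`, so there are candidates; a maximum for the reversed
-- order of distances is a nearest one.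
nearest a near? i = [ (λ none → contradiction (Fin.punchInᵢ≢i i zero) (none (punchIn i zero))) , id ]′
  (maximum {P = _≢ i} {R = λ j k → dist² (a i) (a k) ≤ dist² (a i) (a j)}
    (λ j → ¬? (j Fin.≟ i)) (λ j k → near? i k j) ≰⇒≥ (λ p q → ≤-trans q p))

-- By injectivity at most one entry is zero. If there is none, an arbitrary index is dropped, so
-- that the same number of slopes remains in both cases.
all-but-one-nonzero : ∀ {n} (a : Fin (suc n) → ℂ) → (∀ {i j} → a i ≈ a j → i ≡ j) →
  (∀ j → Dec (dist² (a j) 0ᶜ ≤ 0ℝ)) → ∃[ z ] (∀ j → ¬ dist² (a (punchIn z j)) 0ᶜ ≤ 0ℝ)
all-but-one-nonzero a a-injective zero? with Fin.any? zero?
... | yes (z , a≈0) = z , λ j a′≈0 → Fin.punchInᵢ≢i z j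
        (a-injective (≈-trans (dist²≤0⇒≈ a′≈0) (≈-sym (dist²≤0⇒≈ a≈0))))
... | no none = zero , λ j a≈0 → none (punchIn zero j , a≈0)

-- `σ` names an entry of `B` for every a + bc. The decisions about reals are parameters, to be
-- supplied later under a double negation.
module _ {n m : ℕ} (a : Fin (suc (suc n)) → ℂ) (a-injective : ∀ {i j} → a i ≈ a j → i ≡ j)
  (B : Fin m → ℂ) (σ : Fin (suc (suc n)) → Fin (suc (suc n)) → Fin (suc (suc n)) → Fin m)
  (σ-≈ : ∀ i j k → a i +ᶜ a j *ᶜ a k ≈ B (σ i j k))
  (zero? : ∀ j → Dec (dist² (a j) 0ᶜ ≤ 0ℝ))
  (near? : ∀ i j k → Dec (dist² (a i) (a j) ≤ dist² (a i) (a k)))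
  (ball? : ∀ s t t′ → Dec (dist² (B s) (B t) ≤ dist² (B s) (B t′)))
  (equal? : ∀ t s → Dec (dist² (B t) (B s) ≤ 0ℝ))
  (re? : ∀ t s → Dec (0ℝ ≤ Δre (B t) (B s)))
  (im? : ∀ t s → Dec (0ℝ ≤ Δim (B t) (B s)))
  (diag? : ∀ t s → Dec (0ℝ ≤ Δdiag (B t) (B s))) where

  nn : Fin (suc (suc n)) → Fin (suc (suc n))
  nn k = proj₁ (nearest a near? k)

  nz : ∃[ z ] (∀ j → ¬ dist² (a (punchIn z j)) 0ᶜ ≤ 0ℝ)
  nz = all-but-one-nonzero a a-injective zero?

  β : Fin (suc n) → Fin (suc (suc n))
  β = punchIn (proj₁ nz)

  φ ψ : Fin (suc (suc n)) → Fin (suc n) → Fin (suc (suc n)) → Fin m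
  φ i j k = σ i (β j) k
  ψ i j k = σ i (β j) (nn k)

  -- `line-through` applies at `a k` and `a (nn k)`, which differ because a nearest neighbour has
  -- another index.
  φψ-injective : ∀ k {i j i′ j′} → φ i j k ≡ φ i′ j′ k → ψ i j k ≡ ψ i′ j′ k → i ≡ i′ × j ≡ j′
  φψ-injective k {i} {j} {i′} {j′} p q =
    let ai≈ , aj≈ = line-through {a i} {a i′} {a (β j)} {a (β j′)} {a k} {a (nn k)}
                      (λ e → proj₁ (proj₂ (nearest a near? k)) (sym (a-injective e)))
                      (via (σ-≈ i (β j) k) p (σ-≈ i′ (β j′) k))
                      (via (σ-≈ i (β j) (nn k)) q (σ-≈ i′ (β j′) (nn k)))
    in a-injective ai≈ , Fin.punchIn-injective (proj₁ nz) j j′ (a-injective aj≈)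
    where
    via : ∀ {z w s t} → z ≈ B s → s ≡ t → w ≈ B t → z ≈ w
    via p refl q = ≈-trans p (≈-sym q)

  -- The sixteen classes: coincidence with B t, and the octant of B s around B t.
  class : Fin m → Fin m → Fin 16
  class t s = combine (bit (equal? t s)) (combine (bit (re? t s)) (combine (bit (im? t s)) (bit (diag? t s))))

  -- If two discs contain `B t`, each centre is at least as far from the other centre as from `B t`.
  -- Centres in one class then both coincide with `B t`, whence k = k′, or contradict `sector`.
  multiplicity : ∀ i j t → count (λ k → ball? (φ i j k) t (ψ i j k)) ℕ.≤ 16
  multiplicity i j t = count≤classes (λ k → ball? (φ i j k) t (ψ i j k)) (λ k → class t (φ i j k)) separate
    where
    separate : ∀ k k′ → dist² (B (φ i j k)) (B t) ≤ dist² (B (φ i j k)) (B (ψ i j k)) →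
               dist² (B (φ i j k′)) (B t) ≤ dist² (B (φ i j k′)) (B (ψ i j k′)) →
               class t (φ i j k) ≡ class t (φ i j k′) → k ≡ k′
    -- Equality of indices is decidable, so k ≢ k′ may be assumed; the nearest-neighbour inequality
    -- needs it.
    separate k k′ l l′ eq = decidable-stable (k Fin.≟ k′) λ k≢k′ →
      case bit≡⇒ (equal? t s) (equal? t s′) e₀ of λ
        { (inj₁ (t≈s , t≈s′)) → k≢k′ (a-injective (affine-injective (a i) {a (β j)} {a k} {a k′} (proj₂ nz j)
            (≈-trans {a i +ᶜ a (β j) *ᶜ a k} {B s} {a i +ᶜ a (β j) *ᶜ a k′} (σ-≈ i (β j) k)
              (≈-trans {B s} {B s′} {a i +ᶜ a (β j) *ᶜ a k′}
                (≈-trans (≈-sym (dist²≤0⇒≈ t≈s)) (dist²≤0⇒≈ t≈s′))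
                (≈-sym {a i +ᶜ a (β j) *ᶜ a k′} {B s′} (σ-≈ i (β j) k′))))))
        ; (inj₂ (t≉s , t≉s′)) → ≰0*≰0⇒≰0 {dist² (B t) (B s)} {dist² (B t) (B s′)} t≉s t≉s′
            (sector (B t) (B s) (B s′) (within k k′ (k≢k′ ∘ sym) l)
              (≤-trans (within k′ k k≢k′ l′) (≃⇒≤ (dist²-sym (B s′) (B s))))
              (same-sign {Δre (B t) (B s)} {Δre (B t) (B s′)} (bit≡⇒ (re? t s) (re? t s′) e₁))
              (same-sign {Δim (B t) (B s)} {Δim (B t) (B s′)} (bit≡⇒ (im? t s) (im? t s′) e₂))
              (same-sign {Δdiag (B t) (B s)} {Δdiag (B t) (B s′)} (bit≡⇒ (diag? t s) (diag? t s′) e₃))) }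
      where
      s s′ : Fin m
      s  = φ i j k
      s′ = φ i j k′
      split₀ = Fin.combine-injective (bit (equal? t s)) _ (bit (equal? t s′)) _ eq
      e₀ = proj₁ split₀
      split₁ = Fin.combine-injective (bit (re? t s)) _ (bit (re? t s′)) _ (proj₂ split₀)
      e₁ = proj₁ split₁
      split₂ = Fin.combine-injective (bit (im? t s)) (bit (diag? t s)) (bit (im? t s′)) (bit (diag? t s′)) (proj₂ split₁)
      e₂ = proj₁ split₂
      e₃ = proj₂ split₂
      -- The radius is |b| times the distance from `a k` to its nearest neighbour, hence at most the
      -- distance between the two centres.
      within : ∀ k k′ → k′ ≢ k → dist² (B (φ i j k)) (B t) ≤ dist² (B (φ i j k)) (B (ψ i j k)) →
               dist² (B t) (B (φ i j k)) ≤ dist² (B (φ i j k)) (B (φ i j k′))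
      within k k′ k′≢k l = ≤-trans (≃⇒≤ (dist²-sym (B t) (B (φ i j k)))) (≤-trans l
        (dist²-mono {a i +ᶜ a (β j) *ᶜ a k} {B (φ i j k)} {a i +ᶜ a (β j) *ᶜ a (nn k)} {B (ψ i j k)}
          {a i +ᶜ a (β j) *ᶜ a k′} {B (φ i j k′)} (σ-≈ i (β j) k) (σ-≈ i (β j) (nn k)) (σ-≈ i (β j) k′)
          (affine-mono (a i) (a (β j)) {a k} {a (nn k)} {a k′} (proj₂ (proj₂ (nearest a near? k)) k′ k′≢k))))

  size-bound : suc (suc n) ℕ.* (suc n ℕ.* suc (suc n)) ℕ.≤ 4 ℕ.* (16 ℕ.* (m ℕ.* m))
  size-bound = nearest-triples-≤ (λ t s t′ → dist² (B s) (B t) ≤ dist² (B s) (B t′)) (λ t s t′ → ball? s t t′)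
    -- An inhabited `Fin m` witnesses that m is non-zero.
    ≰⇒≥ ≤-trans φ ψ φψ-injective 16 {{_}} {{Fin.nonZeroIndex (σ zero zero zero)}} multiplicity

-- Supplying the decisions under a double negation

¬¬-∀ : ∀ {n} {P : Fin n → Set} → (∀ i → ¬ ¬ P i) → ¬ ¬ (∀ i → P i)
¬¬-∀ = Fin.sequence (RawMonad.rawApplicative ¬¬-Monad)

¬¬-dec₁ : ∀ {n} {P : Fin n → Set} → ¬ ¬ (∀ i → Dec (P i))
¬¬-dec₁ = ¬¬-∀ λ _ → ¬¬-excluded-middle

¬¬-dec₂ : ∀ {n m} {P : Fin n → Fin m → Set} → ¬ ¬ (∀ i j → Dec (P i j))
¬¬-dec₂ = ¬¬-∀ λ _ → ¬¬-dec₁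

¬¬-dec₃ : ∀ {n m p} {P : Fin n → Fin m → Fin p → Set} → ¬ ¬ (∀ i j k → Dec (P i j k))
¬¬-dec₃ = ¬¬-∀ λ _ → ¬¬-dec₂

lookup-injective : ∀ {A} → Unique A → ∀ {i j} → lookup A i ≈ lookup A j → i ≡ j
lookup-injective (x∉ ∷ u) {zero}  {zero}  p = refl
lookup-injective (x∉ ∷ u) {zero}  {suc j} p = contradiction p (All.lookup x∉ (∈.∈-lookup j))
lookup-injective (x∉ ∷ u) {suc i} {zero}  p = contradiction (≈-sym p) (All.lookup x∉ (∈.∈-lookup i))
lookup-injective (x∉ ∷ u) {suc i} {suc j} p = cong suc (lookup-injective u p)

-- Since N ≤ 2(N - 1), `size-bound` yields N³ ≤ 128m².
cube-bound : ∀ A → 2 ℕ.≤ length A → Unique A → ∀ B → (A + A ∙ A) ⊆ (_∈ B) →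
  let N = length A ; m = length B in N ℕ.* (N ℕ.* N) ℕ.≤ (12 ℕ.* m) ℕ.* (12 ℕ.* m)
cube-bound A@(_ ∷ _ ∷ A′) (s≤s (s≤s z≤n)) u B sub = begin
  N ℕ.* (N ℕ.* N)                      ≤⟨ ℕ.*-monoʳ-≤ N (ℕ.*-monoˡ-≤ N N≤2n) ⟩
  N ℕ.* ((2 ℕ.* suc n) ℕ.* N)          ≡⟨ pull (suc n) N ⟩
  2 ℕ.* (N ℕ.* (suc n ℕ.* N))          ≤⟨ ℕ.*-monoʳ-≤ 2 bound ⟩
  -- 128 is rounded up to 144 = 12², so that the square root of the bound is the natural number 12m.
  2 ℕ.* (4 ℕ.* (16 ℕ.* (m ℕ.* m)))     ≤⟨ ℕ.m≤m+n _ (16 ℕ.* (m ℕ.* m)) ⟩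
  2 ℕ.* (4 ℕ.* (16 ℕ.* (m ℕ.* m))) ℕ.+ 16 ℕ.* (m ℕ.* m)  ≡⟨ square m ⟩
  (12 ℕ.* m) ℕ.* (12 ℕ.* m)            ∎
  where
  open ℕ.≤-Reasoning
  n = length A′
  N = length A
  m = length B
  pull : ∀ p N → N ℕ.* ((2 ℕ.* p) ℕ.* N) ≡ 2 ℕ.* (N ℕ.* (p ℕ.* N))
  pull = solve-∀
  square : ∀ m → 2 ℕ.* (4 ℕ.* (16 ℕ.* (m ℕ.* m))) ℕ.+ 16 ℕ.* (m ℕ.* m) ≡ (12 ℕ.* m) ℕ.* (12 ℕ.* m)
  square = solve-∀
  N≤2n : N ℕ.≤ 2 ℕ.* suc n
  N≤2n = s≤s (ℕ.≤-trans (s≤s (ℕ.m≤m+n n _)) (ℕ.≤-reflexive (sym (ℕ.+-suc n _))))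
  a = lookup A
  in-A : ∀ i → a i ∈ A
  in-A = ∈ₛ.∈-lookup ℂ-setoid A
  hit : ∀ i j k → a i +ᶜ a j *ᶜ a k ∈ B
  hit i j k = sub (a i , a j , a k , in-A i , in-A j , in-A k , ≈-refl)
  bound : N ℕ.* (suc n ℕ.* N) ℕ.≤ 4 ℕ.* (16 ℕ.* (m ℕ.* m))
  bound = decidable-stable (_ ℕ.≤? _) λ ¬bound →
    ¬¬-dec₁ λ zero? → ¬¬-dec₃ λ near? → ¬¬-dec₃ λ ball? → ¬¬-dec₂ λ equal? →
    ¬¬-dec₂ λ re? → ¬¬-dec₂ λ im? → ¬¬-dec₂ λ diag? →
    ¬bound (size-bound a (lookup-injective u) (lookup B) (λ i j k → Any.index (hit i j k))
      (λ i j k → Any.lookup-index (hit i j k)) zero? near? ball? equal? re? im? diag?)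

-- The logarithm and the final constant

½≤ratio : ∀ n → ½ ℚ.≤ ratio (suc n)
½≤ratio n = subst₂ ℚ._≤_ (cong (ℚ._- δ 1) (ratio+δ (suc n)))
  (solve 2 (λ r d → r :+ d :- d := r) refl (ratio (suc n)) (δ (suc n)))
  (ℚ.+-monoʳ-≤ (ratio (suc n) ℚ.+ δ (suc n)) (ℚ.neg-antimono-≤ (δ-antimono {1} {suc n} (s≤s z≤n))))

-- All terms of the Mercator series are non-negative, and the first one alone is 1 - 1/(n + 2) ≥
-- 1/2. The summand `0ℚ` fits the hypothesis of `<root`.
¼<logSum : ∀ n k → 1 ℕ.≤ k → 0ℚ ℚ.+ ½ ℚ.* ½ ℚ.< logSum (ratio (suc n)) k
¼<logSum n k 1≤k = begin-strict
  0ℚ ℚ.+ ½ ℚ.* ½           <⟨ ½p<p 0<½ ⟩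
  ½                        ≤⟨ ½≤ratio n ⟩
  ratio (suc n)            ≡⟨ solve 1 (λ r → r := con 0ℚ :+ r :* con 1ℚ :* con 1ℚ) refl (ratio (suc n)) ⟩
  logSum (ratio (suc n)) 1 ≤⟨ logSum-mono′ (0≤ratio (suc n)) (ℕ.≤⇒≤′ 1≤k) ⟩
  logSum (ratio (suc n)) k ∎
  where open ℚ.≤-Reasoning

-- A grid root falls short of the true root by less than one step, so √(1/4) = 1/2 loses less than
-- 1/4 once the step is below 1/4.
¼<√log : ∀ {n} → 2 ℕ.≤ n → ∃[ M ] (∀ k → M ℕ.≤ k → ½ ℚ.* ½ ℚ.< seq (√ (log n)) k)
¼<√log {suc (suc n)} (s≤s (s≤s z≤n)) =
  let M , g = archimedean (0<* 0<½ 0<½)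
  -- From index 1 on, the partial sum contains the first term.
  in 1 ℕ.⊔ M , λ k a → subst (ℚ._< seq (√ (log (suc (suc n)))) k) (ℚ.+-identityˡ (½ ℚ.* ½))
       (<root {½ ℚ.* ½} {½} {seq (log (suc (suc n))) k} {seq (√ (log (suc (suc n)))) k} {δ k}
         (0≤gridRoot (seq (log (suc (suc n))) k) (0<δ k) (rootBound (seq (log (suc (suc n))) k) k))
         (0<δ k) ℚ.≤-refl (g k (ℕ.m⊔n≤o⇒n≤o 1 M a))
         (¼<logSum n k (ℕ.m⊔n≤o⇒m≤o 1 M a)) (<root² (seq (log (suc (suc n))) k) k))

recip≤4 : ∀ {p} → ½ ℚ.* ½ ℚ.< p → recip p ℚ.≤ fromℕℚ 4
recip≤4 {p} ¼<p = begin
  recip p                              ≡⟨ solve 1 (λ r → r := con (fromℕℚ 4) :* (r :* (con ½ :* con ½))) refl (recip p) ⟩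
  fromℕℚ 4 ℚ.* (recip p ℚ.* (½ ℚ.* ½)) ≤⟨ ℚ.*-monoˡ-≤-nonNeg (fromℕℚ 4) (ℚ.*-monoˡ-≤-nonNeg (recip p)
                                            {{ℚ.nonNegative (ℚ.<⇒≤ (0<recip 0<p))}} (ℚ.<⇒≤ ¼<p)) ⟩
  fromℕℚ 4 ℚ.* (recip p ℚ.* p)         ≡⟨ cong (fromℕℚ 4 ℚ.*_) (recip-inverse 0<p) ⟩
  fromℕℚ 4 ℚ.* 1ℚ                      ≡⟨ ℚ.*-identityʳ (fromℕℚ 4) ⟩
  fromℕℚ 4                             ∎
  where
  open ℚ.≤-Reasoning
  0<p : 0ℚ ℚ.< p
  0<p = ℚ.<-trans (0<* 0<½ 0<½) ¼<p

square-≤⇒≤ : ∀ {p q} → 0ℚ ℚ.≤ p → 0ℚ ℚ.≤ q → p ℚ.* p ℚ.≤ q ℚ.* q → p ℚ.≤ q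
square-≤⇒≤ {p} {q} 0≤p 0≤q l with p ℚ.≤? q
... | yes p≤q = p≤q
... | no  p≰q = contradiction (ℚ.<-≤-trans (ℚ.≤-<-trans
    (ℚ.*-monoˡ-≤-nonNeg q {{ℚ.nonNegative 0≤q}} (ℚ.<⇒≤ q<p))
    (ℚ.*-monoˡ-<-pos p {{ℚ.positive (ℚ.≤-<-trans 0≤q q<p)}} q<p)) l) (ℚ.<-irrefl refl)
  where q<p = ℚ.≰⇒> p≰q

-- Grid roots never exceed the true root, so the square of each approximation is at most N³; no
-- error term arises.
^1·5-≤ : ∀ {N M} k → N ℕ.* (N ℕ.* N) ℕ.≤ M ℕ.* M → seq (fromℕ N ^1·5) k ℚ.≤ fromℕℚ M
^1·5-≤ {N} {M} k N³≤M² = square-≤⇒≤ (0≤* (0≤fromℕℚ N) 0≤r) (0≤fromℕℚ M) (begin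
  (n ℚ.* r) ℚ.* (n ℚ.* r)      ≡⟨ solve 2 (λ n r → (n :* r) :* (n :* r) := n :* n :* (r :* r)) refl n r ⟩
  n ℚ.* n ℚ.* (r ℚ.* r)        ≤⟨ ℚ.*-monoˡ-≤-nonNeg (n ℚ.* n) {{ℚ.nonNegative (0≤* (0≤fromℕℚ N) (0≤fromℕℚ N))}}
                                    (gridRoot²≤ n (δ k) (rootBound n k) (0≤fromℕℚ N) ℚ.≤-refl) ⟩
  n ℚ.* n ℚ.* n                ≡⟨ ℚ.*-assoc n n n ⟩
  n ℚ.* (n ℚ.* n)              ≡⟨ trans (fromℕℚ-* N (N ℕ.* N)) (cong (n ℚ.*_) (fromℕℚ-* N N)) ⟨
  fromℕℚ (N ℕ.* (N ℕ.* N))     ≤⟨ fromℕℚ-mono N³≤M² ⟩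
  fromℕℚ (M ℕ.* M)             ≡⟨ fromℕℚ-* M M ⟩
  fromℕℚ M ℚ.* fromℕℚ M        ∎)
  where
  open ℚ.≤-Reasoning
  n = fromℕℚ N
  r = seq (√ (fromℕ N)) k
  0≤r : 0ℚ ℚ.≤ r
  0≤r = 0≤gridRoot n (0<δ k) (rootBound n k)

-- `δ` is shifted by one: `δ 47` is 1/48, and 48 = 12 · 4.
δ47*[12m*4] : ∀ m → δ 47 ℚ.* (fromℕℚ (12 ℕ.* m) ℚ.* fromℕℚ 4) ≡ fromℕℚ m
δ47*[12m*4] m = trans (cong (δ 47 ℚ.*_) (sym (fromℕℚ-* (12 ℕ.* m) 4)))
  (trans (cong (λ z → δ 47 ℚ.* fromℕℚ z) (48m m))
  (trans (cong (δ 47 ℚ.*_) (fromℕℚ-* 48 m))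
  (trans (sym (ℚ.*-assoc (δ 47) (fromℕℚ 48) (fromℕℚ m)))
  (trans (cong (ℚ._* fromℕℚ m) (δ-inverse 47)) (ℚ.*-identityˡ (fromℕℚ m))))))
  where
  48m : ∀ m → 12 ℕ.* m ℕ.* 4 ≡ 48 ℕ.* m
  48m m = trans (ℕ.*-comm (12 ℕ.* m) 4) (sym (ℕ.*-assoc 4 12 m))

scaled-quotient≤ : ∀ {x L} m → x ℚ.≤ fromℕℚ (12 ℕ.* m) → ½ ℚ.* ½ ℚ.< L →
                   δ 47 ℚ.* (x ℚ.* recip L) ℚ.≤ fromℕℚ m
scaled-quotient≤ {x} {L} m x≤12m ¼<L = begin
  δ 47 ℚ.* (x ℚ.* recip L)                    ≤⟨ ℚ.*-monoˡ-≤-nonNeg (δ 47) {{ℚ.nonNegative (ℚ.<⇒≤ (0<δ 47))}}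
                                                   (ℚ.*-monoʳ-≤-nonNeg (recip L) {{ℚ.nonNegative 0≤1/L}} x≤12m) ⟩
  δ 47 ℚ.* (fromℕℚ (12 ℕ.* m) ℚ.* recip L)    ≤⟨ ℚ.*-monoˡ-≤-nonNeg (δ 47) {{ℚ.nonNegative (ℚ.<⇒≤ (0<δ 47))}}
                                                   (ℚ.*-monoˡ-≤-nonNeg (fromℕℚ (12 ℕ.* m))
                                                     {{ℚ.nonNegative (0≤fromℕℚ (12 ℕ.* m))}} (recip≤4 ¼<L)) ⟩
  δ 47 ℚ.* (fromℕℚ (12 ℕ.* m) ℚ.* fromℕℚ 4)   ≡⟨ δ47*[12m*4] m ⟩
  fromℕℚ m                                    ∎
  where
  open ℚ.≤-Reasoning
  0≤1/L : 0ℚ ℚ.≤ recip L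
  0≤1/L = ℚ.<⇒≤ (0<recip (ℚ.<-trans (0<* 0<½ 0<½) ¼<L))

-- Division matches on the positivity proof, so the equation holds by computation only after the
-- same match.
seq-÷ : ∀ {x y} (0<y : 0ℝ < y) k → seq (x ÷ y ⟨ 0<y ⟩) k ≡ seq x k ℚ.* recip (seq y k)
seq-÷ (mk< _ _ _) k = refl

eventually-≤⇒≤ : ∀ {x} m → ∃[ N ] (∀ k → N ℕ.≤ k → seq x k ℚ.≤ fromℕℚ m) → x ≤ fromℕ m
eventually-≤⇒≤ {x} m (N , h) = mk≤ λ {ε} 0<ε → N , λ k N≤k → ℚ.≤-<-trans (h k N≤k)
  (subst (ℚ._< fromℕℚ m ℚ.+ ε) (ℚ.+-identityʳ (fromℕℚ m)) (ℚ.+-monoʳ-< (fromℕℚ m) 0<ε))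

ratℝ-pos : ∀ {q} → 0ℚ ℚ.< q → 0ℝ < ratℝ q
ratℝ-pos {q} 0<q = mk< (½ ℚ.* q) (0<* 0<½ 0<q) (0 , λ _ _ → ½p<p 0<q)

-- 1/48 = 1/(12 · 4), from |A|^{3/2} ≤ 12|B| and √ log |A| > 1/4.
corollary1p7 : ∃[ c ] (0ℝ < c × (∀ (A : List ℂ) → Unique A → (2≤∣A∣ : 2 ℕ.≤ length A) →
    ∣ A + A ∙ A ∣≥ c * (fromℕ (length A) ^1·5 ÷ √ (log (length A)) ⟨ √-pos (log-pos 2≤∣A∣) ⟩)))
corollary1p7 = ratℝ (δ 47) , ratℝ-pos (0<δ 47) , λ A u 2≤∣A∣ B sub →
  let n = length A
      m = length B
      N , ¼<√logₖ = ¼<√log {n} 2≤∣A∣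
  in eventually-≤⇒≤ m (N , λ k N≤k →
       subst (λ q → δ 47 ℚ.* q ℚ.≤ fromℕℚ m)
         (sym (seq-÷ {fromℕ n ^1·5} {√ (log n)} (√-pos (log-pos 2≤∣A∣)) k))
         (scaled-quotient≤ {seq (fromℕ n ^1·5) k} {seq (√ (log n)) k} m
           (^1·5-≤ {n} {12 ℕ.* m} k (cube-bound A 2≤∣A∣ u B sub)) (¼<√logₖ k N≤k)))
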